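{- There are absolute constants $c_1,c_2>0$ such that for all integers $m\ge 1$ and $k\ge 1$ there is an interval graph $G_{m,k}$ with $|V(G_{m,k})|\le c_1(m+k)$ and two reconfigurable independent sets $I$, $J$ of size $k$ in $G_{m,k}$ such that every reconfiguration sequence from $I$ to $J$ in $G_{m,k}$ has length at least $c_2\cdot k^2\cdot m$.
   Context: All graphs are finite and simple. A graph is an interval graph if its vertices can be associated with intervals on the real line so that two distinct vertices are adjacent if and only if the corresponding intervals intersect. For a graph $G$ and a positive integer $k$, the reconfiguration graph $R_k(G)$ has as vertices all independent sets of size $k$ in $G$; two such sets $I,J$ are adjacent in $R_k(G)$ whenever $I\triangle J=\{u,v\}$ with $uv\in E(G)$ (token sliding). Two independent sets of size $k$ are reconfigurable if they lie in the same connected component of $R_k(G)$. Given a path $(I_0,\ldots,I_M)$ in $R_k(G)$ with $I_0=I$, $I_M=J$, let $(u_i,v_i)$ be given by $I_{i-1}\setminus I_i=\{u_i\}$, $I_i\setminus I_{i-1}=\{v_i\}$; then $((u_1,v_1),\ldots,(u_M,v_M))$ is called a reconfiguration sequence from $I$ to $J$ in $G$, of length $M$. -}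

module Defs where

open import Data.Bool.Properties using () renaming (_≟_ to _≟ᵇ_)
open import Data.Fin using (Fin)
open import Data.Fin.Properties using (any?)
open import Data.Fin.Subset using (Subset; _∈_; _∪_; _─_; ⁅_⁆; ∣_∣)
open import Data.Fin.Subset.Properties
  using (∪-comm; x∈p∪q⁺; x∈p∪q⁻; x∈⁅x⁆)
open import Data.Integer using (+_)
open import Data.List using (List; []; _∷_)
open import Data.Nat using (ℕ)
open import Data.Product using (∃; _×_; _,_)
open import Data.Rational using (ℚ; _<_; _/_)
open import Data.Sum using (_⊎_; inj₁; [_,_]′)
open import Data.Vec using (_∷_; there)
open import Data.Vec.Properties using (≡-dec)
open import Data.Bool using (true; false)
open import Function using (_⇔_)
open import Relation.Binary using (Decidable; Irreflexive; Symmetric)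
open import Relation.Binary.Construct.Closure.ReflexiveTransitive using (Star)
open import Relation.Binary.PropositionalEquality as ≡ using (_≡_; _≢_; refl)
open import Relation.Nullary using (¬_)
open import Relation.Nullary.Decidable using (_×-dec_)

fromℕ : ℕ → ℚ
fromℕ n = + n / 1

-- Dedekind cuts: L q means q < x, and U q means x < q.

record ℝ : Set₁ where
  field
    L U         : ℚ → Set
    L-inhabited : ∃ L
    U-inhabited : ∃ U
    L-rounded   : ∀ q → L q ⇔ (∃ λ r → q < r × L r)
    U-rounded   : ∀ q → U q ⇔ (∃ λ r → r < q × U r)
    disjoint    : ∀ q → ¬ (L q × U q)
    located     : ∀ q r → q < r → L q ⊎ U r

infix 4 _≤ᴿ_

_≤ᴿ_ : ℝ → ℝ → Set
x ≤ᴿ y = ∀ q → ℝ.L x q → ℝ.L y q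

record Interval : Set₁ where
  field
    left right : ℝ
    left≤right : left ≤ᴿ right

_∈ᴵ_ : ℝ → Interval → Set
x ∈ᴵ A = Interval.left A ≤ᴿ x × x ≤ᴿ Interval.right A

Intersect : Interval → Interval → Set₁
Intersect A B = ∃ λ x → x ∈ᴵ A × x ∈ᴵ B

-- Simple graphs; decidability of adjacency is no restriction classically.

record Graph (V : Set) : Set₁ where
  field
    Adj    : V → V → Set
    sym    : Symmetric Adj
    irrefl : Irreflexive _≡_ Adj
    adj?   : Decidable Adj

IsIntervalGraph : {V : Set} → Graph V → Set₁
IsIntervalGraph {V} G =
  ∃ λ (interval : V → Interval) →
    ∀ u v → u ≢ v → Graph.Adj G u v ⇔ Intersect (interval u) (interval v)

SameComponent : {V : Set} → Graph V → V → V → Set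
SameComponent G = Star (Graph.Adj G)

infixl 5 _△_

_△_ : ∀ {n} → Subset n → Subset n → Subset n
p △ q = (p ─ q) ∪ (q ─ p)

module _ {n : ℕ} (G : Graph (Fin n)) where

  Independent : Subset n → Set
  Independent S = ∀ u v → u ∈ S → v ∈ S → ¬ Graph.Adj G u v

  -- The proofs are irrelevant so that vertices of the reconfiguration graph
  -- are equal exactly when the underlying sets are.

  record IndependentSet (k : ℕ) : Set where
    constructor mkIndependentSet
    field
      set          : Subset n
      .independent : Independent set
      .size        : ∣ set ∣ ≡ k

open IndependentSet public using (set)

private
  x∉p─p : ∀ {n} (p : Subset n) {x} → ¬ (x ∈ p ─ p)
  x∉p─p (true  ∷ p) (there x∈) = x∉p─p p x∈
  x∉p─p (false ∷ p) (there x∈) = x∉p─p p x∈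

R : (k : ℕ) {n : ℕ} (G : Graph (Fin n)) → Graph (IndependentSet G k)
R k G = record
  { Adj    = λ I J → ∃ λ u → ∃ λ v → set I △ set J ≡ ⁅ u ⁆ ∪ ⁅ v ⁆ × Graph.Adj G u v
  ; sym    = λ { {I} {J} (u , v , eq , uv) →
                 u , v , ≡.trans (∪-comm (set J ─ set I) (set I ─ set J)) eq , uv }
  ; irrefl = λ { {I} refl (u , v , eq , uv) →
                 [ x∉p─p (set I) , x∉p─p (set I) ]′
                   (x∈p∪q⁻ (set I ─ set I) (set I ─ set I)
                     (≡.subst (u ∈_) (≡.sym eq) (x∈p∪q⁺ (inj₁ (x∈⁅x⁆ u))))) }
  ; adj?   = λ I J → any? λ u → any? λ v →
                 ≡-dec _≟ᵇ_ (set I △ set J) (⁅ u ⁆ ∪ ⁅ v ⁆) ×-dec Graph.adj? G u v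
  }

Reconfigurable : ∀ {n k} (G : Graph (Fin n)) → IndependentSet G k → IndependentSet G k → Set
Reconfigurable {k = k} G = SameComponent (R k G)

data IsReconfigurationSequence {n k : ℕ} (G : Graph (Fin n)) :
       IndependentSet G k → IndependentSet G k → List (Fin n × Fin n) → Set where
  []   : ∀ {I} → IsReconfigurationSequence G I I []
  step : ∀ {I I′ J u v moves} →
         Graph.Adj (R k G) I I′ →
         set I ─ set I′ ≡ ⁅ u ⁆ →
         set I′ ─ set I ≡ ⁅ v ⁆ →
         IsReconfigurationSequence G I′ J moves →
         IsReconfigurationSequence G I J ((u , v) ∷ moves)

-- The graph is a corridor: a path of N = 4k + m unit intervals, with s ≈ k/4 isolated parking slots
-- beyond each of its ends.  A slot is entered only through long intervals that start at this slot or at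
-- one further out; a token on such an interval forces all tokens behind it into the slots outside of its
-- start and all tokens ahead of it into the far end of the path and the far slots.
-- The far end left free by the i-th long interval of a side is so short that it can be used only once
-- enough tokens are parked on the opposite side, so the long intervals have to be opened alternately on
-- the left and on the right.  Between two consecutive openings the d = k − 2s tokens in the middle, which
-- cannot use the intervals opened so far, have to walk across the m middle vertices of the path.  This
-- happens 2s + 1 times when all slots are to be filled, which makes (2s + 1) d m ≥ k² m / 8 moves.
--
-- For the lower bound the tokens need no identity: the total displacement of all tokens towards one side,
-- cut off below at s m and above at (s + d) m, grows by at most one per move, because a token on an
-- opened long interval forces this total below s m or above (s + d) m.

module Submission where

open import Defs
open import Data.Bool using (true; false)
open import Data.Fin using (Fin; zero; suc; toℕ; fromℕ<; opposite)
import Data.Fin.Properties as Fin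
open import Data.List using (List; []; _∷_; length; _++_; map)
open import Data.List.Relation.Unary.All as All using (All; []; _∷_)
open import Data.List.Relation.Unary.AllPairs as AllPairs using (AllPairs; []; _∷_)
open import Data.Maybe using (Maybe; just; nothing)
open import Data.Nat using (ℕ; zero; suc; s≤s; z≤n)
open import Data.Nat.ListAction using (sum)
open import Data.Nat.Solver using (module +-*-Solver)
open import Data.Product using (∃; Σ; _×_; _,_; proj₁; proj₂)
open import Data.Sum using (_⊎_; inj₁; inj₂; [_,_]′; swap)
open import Function using (_∘_; _↔_; mk↔ₛ′; mk⇔; Inverse)
open import Relation.Binary.PropositionalEquality
  using (_≡_; _≢_; refl; sym; trans; cong; cong₂; subst; subst₂; setoid; module ≡-Reasoning)
open import Relation.Nullary using (¬_; Dec; yes; no; contradiction)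
open import Relation.Nullary.Decidable using (_×-dec_; _⊎-dec_; map′; recompute)

-- Interval graphs with natural end points

module Intervals where

  open import Data.Integer using (+_)
  import Data.Integer as ℤ
  import Data.Integer.Properties as ℤ
  open import Data.Nat using () renaming (_*_ to _*ℕ_; _≤_ to _≤ℕ_; _<_ to _<ℕ_; _⊔_ to _⊔ℕ_)
  import Data.Nat.Properties as ℕ
  open import Data.Rational using (ℚ; 1ℚ; _<_; _≤_; _+_; _-_; _*_; -_; toℚᵘ)
  import Data.Rational.Properties as ℚ
  import Data.Rational.Unnormalised as ℚᵘ
  import Data.Rational.Unnormalised.Properties as ℚᵘ

  toℚᵘ-fromℕ : ∀ n → toℚᵘ (fromℕ n) ℚᵘ.≃ ℚᵘ.mkℚᵘ (+ n) 0
  toℚᵘ-fromℕ n = ℚ.toℚᵘ-fromℚᵘ (ℚᵘ.mkℚᵘ (+ n) 0)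

  fromℕ-mono-≤ : ∀ {a b} → a ≤ℕ b → fromℕ a ≤ fromℕ b
  fromℕ-mono-≤ {a} {b} a≤b = ℚ.toℚᵘ-cancel-≤ (begin
    toℚᵘ (fromℕ a)      ≃⟨ toℚᵘ-fromℕ a ⟩
    ℚᵘ.mkℚᵘ (+ a) 0     ≤⟨ ℚᵘ.*≤* (ℤ.*-monoʳ-≤-nonNeg (+ 1) (ℤ.+≤+ a≤b)) ⟩
    ℚᵘ.mkℚᵘ (+ b) 0     ≃⟨ toℚᵘ-fromℕ b ⟨
    toℚᵘ (fromℕ b)      ∎)
    where open ℚᵘ.≤-Reasoning

  fromℕ-mono-< : ∀ {a b} → a <ℕ b → fromℕ a < fromℕ b
  fromℕ-mono-< {a} {b} a<b = ℚ.toℚᵘ-cancel-< (begin-strict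
    toℚᵘ (fromℕ a)      ≃⟨ toℚᵘ-fromℕ a ⟩
    ℚᵘ.mkℚᵘ (+ a) 0     <⟨ ℚᵘ.*<* (ℤ.*-monoʳ-<-pos (+ 1) (ℤ.+<+ a<b)) ⟩
    ℚᵘ.mkℚᵘ (+ b) 0     ≃⟨ toℚᵘ-fromℕ b ⟨
    toℚᵘ (fromℕ b)      ∎)
    where open ℚᵘ.≤-Reasoning

  fromℕ-* : ∀ a b → fromℕ a * fromℕ b ≡ fromℕ (a *ℕ b)
  fromℕ-* a b = ℚ.toℚᵘ-injective (begin
    toℚᵘ (fromℕ a * fromℕ b)              ≈⟨ ℚ.toℚᵘ-homo-* (fromℕ a) (fromℕ b) ⟩
    toℚᵘ (fromℕ a) ℚᵘ.* toℚᵘ (fromℕ b)    ≈⟨ ℚᵘ.*-cong (toℚᵘ-fromℕ a) (toℚᵘ-fromℕ b) ⟩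
    ℚᵘ.mkℚᵘ (+ a) 0 ℚᵘ.* ℚᵘ.mkℚᵘ (+ b) 0  ≈⟨ ℚᵘ.*≡* (cong (ℤ._* + 1) (sym (ℤ.pos-* a b))) ⟩
    ℚᵘ.mkℚᵘ (+ (a *ℕ b)) 0                ≈⟨ toℚᵘ-fromℕ (a *ℕ b) ⟨
    toℚᵘ (fromℕ (a *ℕ b))                 ∎)
    where open ℚᵘ.≃-Reasoning

  embed : ℚ → ℝ
  embed p = record
    { L = _< p
    ; U = p <_
    ; L-inhabited = p - 1ℚ , subst (p - 1ℚ <_) (ℚ.+-identityʳ p) (ℚ.+-monoʳ-< p (ℚ.negative⁻¹ (- 1ℚ)))
    ; U-inhabited = p + 1ℚ , subst (_< p + 1ℚ) (ℚ.+-identityʳ p) (ℚ.+-monoʳ-< p (ℚ.positive⁻¹ 1ℚ))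
    ; L-rounded = λ q → mk⇔ (λ q<p → let r , q<r , r<p = ℚ.<-dense q<p in r , q<r , r<p)
                            (λ (_ , q<r , r<p) → ℚ.<-trans q<r r<p)
    ; U-rounded = λ q → mk⇔ (λ p<q → let r , p<r , r<q = ℚ.<-dense p<q in r , r<q , p<r)
                            (λ (_ , r<q , p<r) → ℚ.<-trans p<r r<q)
    ; disjoint = λ _ (q<p , p<q) → ℚ.<-asym q<p p<q
    ; located = λ q r q<r → [ (λ p≤q → inj₂ (ℚ.≤-<-trans p≤q q<r)) , inj₁ ]′ (≤⊎> q)
    }
    where
    ≤⊎> : ∀ q → p ≤ q ⊎ q < p
    ≤⊎> q with q ℚ.<? p
    ... | yes q<p = inj₂ q<p
    ... | no  q≮p = inj₁ (ℚ.≮⇒≥ q≮p)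

  natural : ℕ → ℝ
  natural a = embed (fromℕ a)

  natural-mono : ∀ {a b} → a ≤ℕ b → natural a ≤ᴿ natural b
  natural-mono a≤b q q<a = ℚ.<-≤-trans q<a (fromℕ-mono-≤ a≤b)

  -- If `b < a`, then the rational number `b` lies in the lower cut of `a` but not in its own.
  natural-cancel : ∀ {a b} → natural a ≤ᴿ natural b → a ≤ℕ b
  natural-cancel {a} {b} a≤b = ℕ.≮⇒≥ λ b<a → ℚ.<-irrefl refl (a≤b (fromℕ b) (fromℕ-mono-< b<a))

  module _ {V : Set} (G : Graph V) (lo hi : V → ℕ) (lo≤hi : ∀ v → lo v ≤ℕ hi v)
           (overlaps : ∀ {u v} → Graph.Adj G u v → lo u ≤ℕ hi v)
           (separate : ∀ {u v} → u ≢ v → ¬ Graph.Adj G u v → hi u <ℕ lo v ⊎ hi v <ℕ lo u) where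

    isIntervalGraph : IsIntervalGraph G
    isIntervalGraph = I , λ u v u≢v → mk⇔ (to u v) (from u v u≢v)
      where
      I : V → Interval
      I v = record { left = natural (lo v) ; right = natural (hi v) ; left≤right = natural-mono (lo≤hi v) }

      to : ∀ u v → Graph.Adj G u v → Intersect (I u) (I v)
      -- The larger of the two left end points lies in both intervals.
      to u v uv = natural (lo u ⊔ℕ lo v)
        , (natural-mono (ℕ.m≤m⊔n (lo u) (lo v)) , natural-mono (ℕ.⊔-lub (lo≤hi u) (overlaps (Graph.sym G uv))))
        , (natural-mono (ℕ.m≤n⊔m (lo u) (lo v)) , natural-mono (ℕ.⊔-lub (overlaps uv) (lo≤hi v)))

      from : ∀ u v → u ≢ v → Intersect (I u) (I v) → Graph.Adj G u v
      from u v u≢v (x , (lu≤x , x≤hu) , (lv≤x , x≤hv)) with Graph.adj? G u v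
      ... | yes uv = uv
      ... | no ¬uv = [ (λ hu<lv → contradiction (natural-cancel λ q → x≤hu q ∘ lv≤x q) (ℕ.<⇒≱ hu<lv))
                     , (λ hv<lu → contradiction (natural-cancel λ q → x≤hv q ∘ lu≤x q) (ℕ.<⇒≱ hv<lu)) ]′
                     (separate u≢v ¬uv)

-- Weights and counts of token sets

module TokenSets where

  open import Data.Empty.Irrelevant using () renaming (⊥-elim to ⊥-elim-irr)
  open import Data.Fin.Subset using (Subset; _∈_; _∉_; _∪_; _─_; _-_; ⁅_⁆; ∣_∣) renaming (⊥ to ∅)
  open import Data.Fin.Subset.Properties
    using (∉⊥; x∈⁅x⁆; x∈⁅y⁆⇒x≡y; x∈p∪q⁺; x∈p∪q⁻; ⊆-antisym; p─⊥≡p; p─q⊆p; x∈p∧x∉q⇒x∈p─q; x∈p∧x≢y⇒x∈p-y; _∈?_)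
  open import Data.List.Membership.Propositional renaming (_∈_ to _∈ˡ_) using ()
  open import Data.List.Relation.Binary.Permutation.Propositional using (_↭_; ↭-sym; ↭⇒↭ₛ)
  open import Data.List.Relation.Binary.Permutation.Propositional.Properties using (↭-length; ∈-resp-↭)
  import Data.List.Relation.Binary.Permutation.Setoid.Properties as PermSetoid
  open import Data.List.Relation.Unary.Any using (here; there)
  open import Data.Maybe.Properties using () renaming (≡-dec to ≡-decᴹ)
  open import Data.Nat using (_+_; _*_; _≤_; _<_; _≟_)
  import Data.Nat.Properties as ℕ
  open import Data.Vec using (_∷_; []; here; there)
  open import Relation.Binary.Construct.Closure.ReflexiveTransitive using (Star; ε; _◅_; _◅◅_)

  weigh : ∀ {n} → (Fin n → ℕ) → Subset n → ℕ
  weigh f []          = 0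
  weigh f (true  ∷ p) = f zero + weigh (f ∘ suc) p
  weigh f (false ∷ p) = weigh (f ∘ suc) p

  weigh-mono : ∀ {n} {f g : Fin n → ℕ} (p : Subset n) → (∀ {v} → v ∈ p → f v ≤ g v) → weigh f p ≤ weigh g p
  weigh-mono []          f≤g = z≤n
  weigh-mono (true  ∷ p) f≤g = ℕ.+-mono-≤ (f≤g here) (weigh-mono p (f≤g ∘ there))
  weigh-mono (false ∷ p) f≤g = weigh-mono p (f≤g ∘ there)

  weigh-+ : ∀ {n} (f g : Fin n → ℕ) p → weigh (λ v → f v + g v) p ≡ weigh f p + weigh g p
  weigh-+ f g []          = refl
  weigh-+ f g (true  ∷ p) = trans (cong (f zero + g zero +_) (weigh-+ (f ∘ suc) (g ∘ suc) p))
    (solve 4 (λ a b c d → a :+ b :+ (c :+ d) := a :+ c :+ (b :+ d)) refl (f zero) (g zero) _ _)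
    where open +-*-Solver
  weigh-+ f g (false ∷ p) = weigh-+ (f ∘ suc) (g ∘ suc) p

  weigh-* : ∀ {n} c (f : Fin n → ℕ) p → weigh (λ v → c * f v) p ≡ c * weigh f p
  weigh-* c f []          = sym (ℕ.*-zeroʳ c)
  weigh-* c f (true  ∷ p) = trans (cong (c * f zero +_) (weigh-* c (f ∘ suc) p)) (sym (ℕ.*-distribˡ-+ c (f zero) _))
  weigh-* c f (false ∷ p) = weigh-* c (f ∘ suc) p

  weigh-1 : ∀ {n} (p : Subset n) → weigh (λ _ → 1) p ≡ ∣ p ∣
  weigh-1 []          = refl
  weigh-1 (true  ∷ p) = cong suc (weigh-1 p)
  weigh-1 (false ∷ p) = weigh-1 p

  weigh-0 : ∀ {n} (p : Subset n) → weigh (λ _ → 0) p ≡ 0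
  weigh-0 []          = refl
  weigh-0 (true  ∷ p) = weigh-0 p
  weigh-0 (false ∷ p) = weigh-0 p

  weigh-remove : ∀ {n} (f : Fin n → ℕ) {p x} → x ∈ p → weigh f p ≡ f x + weigh f (p - x)
  weigh-remove f {_ ∷ p} here = cong (λ q → f zero + weigh (f ∘ suc) q) (sym (p─⊥≡p p))
  weigh-remove f {true ∷ p} {suc x} (there x∈p) = trans (cong (f zero +_) (weigh-remove (f ∘ suc) x∈p))
    (solve 3 (λ a b c → a :+ (b :+ c) := b :+ (a :+ c)) refl (f zero) (f (suc x)) _)
    where open +-*-Solver
  weigh-remove f {false ∷ p} (there x∈p) = weigh-remove (f ∘ suc) x∈p

  weigh-∅ : ∀ {n} (f : Fin n → ℕ) → weigh f ∅ ≡ 0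
  weigh-∅ {zero}  f = refl
  weigh-∅ {suc n} f = weigh-∅ (f ∘ suc)

  x∈p─q⇒x∉q : ∀ {n} (p q : Subset n) {x} → x ∈ p ─ q → x ∉ q
  x∈p─q⇒x∉q (_ ∷ p) (false ∷ q) (there x∈) (there x∈q) = x∈p─q⇒x∉q p q x∈ x∈q
  x∈p─q⇒x∉q (_ ∷ p) (true  ∷ q) (there x∈) (there x∈q) = x∈p─q⇒x∉q p q x∈ x∈q

  x∈p-y⇒x≢y : ∀ {n} (p : Subset n) {x y} → x ∈ p - y → x ≢ y
  x∈p-y⇒x≢y p {x} x∈ refl = x∈p─q⇒x∉q p ⁅ x ⁆ x∈ (x∈⁅x⁆ x)

  weigh-insert : ∀ {n} (f : Fin n → ℕ) {p x} → x ∉ p → weigh f (⁅ x ⁆ ∪ p) ≡ f x + weigh f p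
  weigh-insert f {p} {x} x∉p = trans (weigh-remove f (x∈p∪q⁺ (inj₁ (x∈⁅x⁆ x))))
                                     (cong (λ q → f x + weigh f q) (⊆-antisym ⊆₁ ⊆₂))
    where
    ⊆₁ : ∀ {y} → y ∈ (⁅ x ⁆ ∪ p) - x → y ∈ p
    ⊆₁ y∈ = [ (λ y∈x → contradiction (x∈⁅y⁆⇒x≡y x y∈x) (x∈p-y⇒x≢y (⁅ x ⁆ ∪ p) y∈)) , (λ y∈p → y∈p) ]′
              (x∈p∪q⁻ ⁅ x ⁆ p (p─q⊆p (⁅ x ⁆ ∪ p) ⁅ x ⁆ y∈))
    ⊆₂ : ∀ {y} → y ∈ p → y ∈ (⁅ x ⁆ ∪ p) - x
    ⊆₂ y∈p = x∈p∧x≢y⇒x∈p-y (x∈p∪q⁺ (inj₂ y∈p)) λ { refl → x∉p y∈p }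

  indicator : Maybe ℕ → ℕ
  indicator (just _) = 1
  indicator nothing  = 0

  count : ∀ {n} → (Fin n → Maybe ℕ) → Subset n → ℕ
  count cell = weigh (indicator ∘ cell)

  -- Pigeonhole principle by induction on the number of cells: the last cell holds at most one
  -- token, and deleting that token leaves only the cells before it.
  count-≤ : ∀ {n} (cell : Fin n → Maybe ℕ) b p →
            (∀ {v j} → v ∈ p → cell v ≡ just j → j < b) →
            (∀ {u v j} → u ∈ p → v ∈ p → cell u ≡ just j → cell v ≡ just j → u ≡ v) →
            count cell p ≤ b
  count-≤ cell zero p bounded distinct = ℕ.≤-trans (weigh-mono {g = λ _ → 0} p outside) (ℕ.≤-reflexive (weigh-0 p))
    where
    outside : ∀ {v} → v ∈ p → indicator (cell v) ≤ 0
    outside {v} v∈p with cell v in eq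
    ... | nothing = z≤n
    ... | just _  = contradiction (bounded v∈p eq) λ ()
  count-≤ cell (suc b) p bounded distinct
    with Fin.any? (λ v → (v ∈? p) ×-dec ≡-decᴹ _≟_ (cell v) (just b))
  ... | no none = ℕ.m≤n⇒m≤1+n (count-≤ cell b p
          (λ v∈p eq → ℕ.≤∧≢⇒< (ℕ.≤-pred (bounded v∈p eq)) λ { refl → none (_ , v∈p , eq) }) distinct)
  ... | yes (v , v∈p , eq) = begin
    count cell p                     ≡⟨ weigh-remove _ v∈p ⟩
    indicator (cell v) + count cell (p - v)          ≤⟨ ℕ.+-mono-≤ one (count-≤ cell b (p - v) bounded′
                                           (λ u∈ w∈ → distinct (p─q⊆p p ⁅ v ⁆ u∈) (p─q⊆p p ⁅ v ⁆ w∈))) ⟩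
    suc b                            ∎
    where
    open ℕ.≤-Reasoning
    one : indicator (cell v) ≤ 1
    one rewrite eq = ℕ.≤-refl
    bounded′ : ∀ {u j} → u ∈ p - v → cell u ≡ just j → j < b
    bounded′ u∈ equ = let u∈p = p─q⊆p p ⁅ v ⁆ u∈ in
      ℕ.≤∧≢⇒< (ℕ.≤-pred (bounded u∈p equ)) λ { refl → x∈p-y⇒x≢y p u∈ (distinct u∈p v∈p equ eq) }

  -- Configurations as lists, and runs between them

  toSet : ∀ {n} → List (Fin n) → Subset n
  toSet []       = ∅
  toSet (v ∷ vs) = ⁅ v ⁆ ∪ toSet vs

  ∈-toSet⁺ : ∀ {n} {v : Fin n} {vs} → v ∈ˡ vs → v ∈ toSet vs
  ∈-toSet⁺ {v = v} (here refl) = x∈p∪q⁺ (inj₁ (x∈⁅x⁆ v))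
  ∈-toSet⁺         (there v∈)  = x∈p∪q⁺ (inj₂ (∈-toSet⁺ v∈))

  ∈-toSet⁻ : ∀ {n} {v : Fin n} vs → v ∈ toSet vs → v ∈ˡ vs
  ∈-toSet⁻ []       v∈ = contradiction v∈ ∉⊥
  ∈-toSet⁻ (u ∷ vs) v∈ = [ here ∘ x∈⁅y⁆⇒x≡y u , there ∘ ∈-toSet⁻ vs ]′ (x∈p∪q⁻ ⁅ u ⁆ (toSet vs) v∈)

  toSet-↭ : ∀ {n} {us vs : List (Fin n)} → us ↭ vs → toSet us ≡ toSet vs
  toSet-↭ {us = us} {vs} us↭vs = ⊆-antisym (∈-toSet⁺ ∘ ∈-resp-↭ us↭vs ∘ ∈-toSet⁻ us)
                                           (∈-toSet⁺ ∘ ∈-resp-↭ (↭-sym us↭vs) ∘ ∈-toSet⁻ vs)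

  module _ {V : Set} (G : Graph V) where

    -- Distinctness is included so that a scattered list has no repetitions and its length is the
    -- size of its set.
    Apart : V → V → Set
    Apart u v = u ≢ v × ¬ Graph.Adj G u v

    Apart-sym : ∀ {u v} → Apart u v → Apart v u
    Apart-sym (u≢v , ¬uv) = (u≢v ∘ sym) , (¬uv ∘ Graph.sym G)

    Scattered : List V → Set
    Scattered = AllPairs Apart

  module _ {n : ℕ} (G : Graph (Fin n)) where
    open Graph G using (Adj)

    Scattered-↭ : ∀ {us vs} → us ↭ vs → Scattered G us → Scattered G vs
    Scattered-↭ us↭vs = PermSetoid.AllPairs-resp-↭ (setoid _) (Apart-sym G)
      ((λ { refl a → a }) , (λ { refl a → a })) (↭⇒↭ₛ us↭vs)

    independent-toSet : ∀ {vs} → Scattered G vs → Independent G (toSet vs)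
    independent-toSet {vs} sc u v u∈ v∈ = go sc (∈-toSet⁻ vs u∈) (∈-toSet⁻ vs v∈)
      where
      go : ∀ {vs u v} → Scattered G vs → u ∈ˡ vs → v ∈ˡ vs → ¬ Adj u v
      go (_  ∷ _)  (here refl) (here refl) = Graph.irrefl G refl
      go (ap ∷ _)  (here refl) (there v∈)  = proj₂ (All.lookup ap v∈)
      go (ap ∷ _)  (there u∈)  (here refl) = proj₂ (All.lookup ap u∈) ∘ Graph.sym G
      go (_  ∷ sc) (there u∈)  (there v∈)  = go sc u∈ v∈

    ∉-toSet : ∀ {v vs} → All (Apart G v) vs → v ∉ toSet vs
    ∉-toSet {v} {vs} ap v∈ = proj₁ (All.lookup ap (∈-toSet⁻ vs v∈)) refl

    weigh-toSet : ∀ (f : Fin n → ℕ) {vs} → Scattered G vs → weigh f (toSet vs) ≡ sum (map f vs)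
    weigh-toSet f []                  = weigh-∅ f
    weigh-toSet f {v ∷ _} (ap ∷ sc) = trans (weigh-insert f (∉-toSet ap)) (cong (f v +_) (weigh-toSet f sc))

    size-toSet : ∀ {vs} → Scattered G vs → ∣ toSet vs ∣ ≡ length vs
    size-toSet {vs} sc = trans (sym (weigh-1 (toSet vs))) (trans (weigh-toSet _ sc) (ones vs))
      where
      ones : ∀ vs → sum (map (λ (_ : Fin n) → 1) vs) ≡ length vs
      ones []       = refl
      ones (_ ∷ vs) = cong suc (ones vs)

    fromList : ∀ {k} vs → .(Scattered G vs) → .(length vs ≡ k) → IndependentSet G k
    fromList vs sc len = mkIndependentSet (toSet vs) (independent-toSet sc) (trans (size-toSet sc) len)

    infix 4 _⇝_

    -- The token that slides is always the head of the list; `reorder` brings another token to the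
    -- head and corresponds to no move at all.
    data _⇝_ : List (Fin n) → List (Fin n) → Set where
      reorder : ∀ {us vs} → us ↭ vs → us ⇝ vs
      slide   : ∀ {u v vs} → Adj u v → All (Apart G v) vs → u ∷ vs ⇝ v ∷ vs
      _then_  : ∀ {us vs ws} → us ⇝ vs → vs ⇝ ws → us ⇝ ws

    infixr 5 _then_

    private
      difference : ∀ {u v : Fin n} p → u ∉ p → u ≢ v → (⁅ u ⁆ ∪ p) ─ (⁅ v ⁆ ∪ p) ≡ ⁅ u ⁆
      difference {u} {v} p u∉p u≢v = ⊆-antisym
        (λ x∈ → [ (λ x∈u → x∈u) , (λ x∈p → contradiction (x∈p∪q⁺ (inj₂ x∈p)) (x∈p─q⇒x∉q _ _ x∈)) ]′
                  (x∈p∪q⁻ ⁅ u ⁆ p (p─q⊆p _ _ x∈)))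
        λ x∈u → x∈p∧x∉q⇒x∈p─q (x∈p∪q⁺ (inj₁ x∈u))
          λ x∈ → [ (λ x∈v → u≢v (trans (sym (x∈⁅y⁆⇒x≡y u x∈u)) (x∈⁅y⁆⇒x≡y v x∈v)))
                 , (λ x∈p → u∉p (subst (_∈ p) (x∈⁅y⁆⇒x≡y u x∈u) x∈p)) ]′ (x∈p∪q⁻ ⁅ v ⁆ p x∈)

    -- Scatteredness and length are carried along the run, so only the initial configuration has to
    -- be checked for independence and size.
    ⇝⇒Reconfigurable : ∀ {us vs k} → us ⇝ vs → (sc : Scattered G us) (len : length us ≡ k) →
                       Σ (Scattered G vs) λ sc′ → Σ (length vs ≡ k) λ len′ →
                       Reconfigurable G (fromList us sc len) (fromList vs sc′ len′)
    ⇝⇒Reconfigurable {us} {vs} {k} (reorder us↭vs) sc len =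
      Scattered-↭ us↭vs sc , trans (sym (↭-length us↭vs)) len , same (toSet-↭ us↭vs)
      where
      -- A reordered list has the same underlying set, and the proofs stored with the set are
      -- irrelevant.
      same : ∀ {p q} .{a b c d} → p ≡ q → Reconfigurable {k = k} G (mkIndependentSet p a b) (mkIndependentSet q c d)
      same refl = ε
    ⇝⇒Reconfigurable {u ∷ ws} {v ∷ _} (slide uv ap) (au ∷ sc) len =
      ap ∷ sc , len , (u , v , cong₂ _∪_ (difference (toSet ws) (∉-toSet au) u≢v)
                                         (difference (toSet ws) (∉-toSet ap) (u≢v ∘ sym)) , uv) ◅ ε
      where
      u≢v : u ≢ v
      u≢v u≡v = Graph.irrefl G u≡v uv
    ⇝⇒Reconfigurable (us⇝vs then vs⇝ws) sc len =
      let sc₁ , len₁ , r₁ = ⇝⇒Reconfigurable us⇝vs sc len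
          sc₂ , len₂ , r₂ = ⇝⇒Reconfigurable vs⇝ws sc₁ len₁
      in  sc₂ , len₂ , r₁ ◅◅ r₂

    -- What a single step of a reconfiguration sequence says

    module _ {k : ℕ} where

      -- The stored proofs are irrelevant, but independence is a negation and equality of numbers is
      -- decidable, so both can be recovered.
      independent : (I : IndependentSet G k) → Independent G (set I)
      independent (mkIndependentSet _ ind _) u v u∈ v∈ uv = ⊥-elim-irr (ind u v u∈ v∈ uv)

      size : (I : IndependentSet G k) → ∣ set I ∣ ≡ k
      size (mkIndependentSet _ _ sz) = recompute (_ ≟ _) sz

      module Slide {u v} (I I′ : IndependentSet G k) (II′ : Graph.Adj (R k G) I I′)
                   (u-leaves : set I ─ set I′ ≡ ⁅ u ⁆) (v-enters : set I′ ─ set I ≡ ⁅ v ⁆) where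

        private
          u∈─ : u ∈ set I ─ set I′
          u∈─ = subst (u ∈_) (sym u-leaves) (x∈⁅x⁆ u)
          v∈─ : v ∈ set I′ ─ set I
          v∈─ = subst (v ∈_) (sym v-enters) (x∈⁅x⁆ v)

        u∈I : u ∈ set I
        u∈I = p─q⊆p _ _ u∈─

        v∈I′ : v ∈ set I′
        v∈I′ = p─q⊆p _ _ v∈─

        -- Adjacency in `R k G` provides some edge whose ends form the symmetric difference. That
        -- set is also made up of `u` and `v`, so the edge joins these two; its ends cannot coincide
        -- by irreflexivity.
        adjacent : Adj u v
        adjacent = let x , y , eq , xy = II′ in
          among xy (locate eq (inj₁ (x∈⁅x⁆ x))) (locate eq (inj₂ (x∈⁅x⁆ y)))
          where
          locate : ∀ {x y z} → set I △ set I′ ≡ ⁅ x ⁆ ∪ ⁅ y ⁆ → z ∈ ⁅ x ⁆ ⊎ z ∈ ⁅ y ⁆ → z ≡ u ⊎ z ≡ v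
          locate {z = z} eq z∈ = [ inj₁ ∘ x∈⁅y⁆⇒x≡y u , inj₂ ∘ x∈⁅y⁆⇒x≡y v ]′
            (x∈p∪q⁻ ⁅ u ⁆ ⁅ v ⁆ (subst (z ∈_) (trans (sym eq) (cong₂ _∪_ u-leaves v-enters)) (x∈p∪q⁺ z∈)))
          among : ∀ {x y} → Adj x y → x ≡ u ⊎ x ≡ v → y ≡ u ⊎ y ≡ v → Adj u v
          among xy (inj₁ refl) (inj₁ refl) = contradiction xy (Graph.irrefl G refl)
          among xy (inj₁ refl) (inj₂ refl) = xy
          among xy (inj₂ refl) (inj₁ refl) = Graph.sym G xy
          among xy (inj₂ refl) (inj₂ refl) = contradiction xy (Graph.irrefl G refl)

        -- The tokens at rest are the same before and after the move, because a token missing from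
        -- one of the two sets would have to be `u` or `v`.
        rest≡ : set I - u ≡ set I′ - v
        rest≡ = ⊆-antisym (λ x∈ → to (x∈p─q⇒x∉q _ _ x∈) (p─q⊆p _ _ x∈) (_ ∈? set I′))
                          (λ x∈ → from (x∈p─q⇒x∉q _ _ x∈) (p─q⊆p _ _ x∈) (_ ∈? set I))
          where
          to : ∀ {x} → x ∉ ⁅ u ⁆ → x ∈ set I → Dec (x ∈ set I′) → x ∈ set I′ - v
          to x∉u x∈I (yes x∈I′) = x∈p∧x∉q⇒x∈p─q x∈I′ λ x∈v →
            x∈p─q⇒x∉q (set I′) (set I) (subst (_ ∈_) (sym v-enters) x∈v) x∈I
          to x∉u x∈I (no x∉I′) = contradiction (subst (_ ∈_) u-leaves (x∈p∧x∉q⇒x∈p─q x∈I x∉I′)) x∉u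
          from : ∀ {x} → x ∉ ⁅ v ⁆ → x ∈ set I′ → Dec (x ∈ set I) → x ∈ set I - u
          from x∉v x∈I′ (yes x∈I) = x∈p∧x∉q⇒x∈p─q x∈I λ x∈u →
            x∈p─q⇒x∉q (set I) (set I′) (subst (_ ∈_) (sym u-leaves) x∈u) x∈I′
          from x∉v x∈I′ (no x∉I) = contradiction (subst (_ ∈_) v-enters (x∈p∧x∉q⇒x∈p─q x∈I′ x∉I)) x∉v

-- The two sides of the corridor

module Sides where

  data Side : Set where
    left right : Side

  opp : Side → Side
  opp left  = right
  opp right = left

  opp-involutive : ∀ σ → opp (opp σ) ≡ σ
  opp-involutive left  = refl
  opp-involutive right = refl

  same-or-opp : ∀ σ τ → τ ≡ σ ⊎ τ ≡ opp σ
  same-or-opp left  left  = inj₁ refl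
  same-or-opp left  right = inj₂ refl
  same-or-opp right left  = inj₂ refl
  same-or-opp right right = inj₁ refl

-- Clamped progress and halving

module Arithmetic where

  open import Data.Nat using (_+_; _*_; _∸_; _≤_; _<_; _⊓_; ⌊_/2⌋)
  open import Data.Nat.Properties

  -- The progress of `t` through the window from `a` to `a + b`: it is `0` before the window and
  -- stays at `b` after it.
  ramp : ℕ → ℕ → ℕ → ℕ
  ramp a b t = (t ∸ a) ⊓ b

  ramp-low : ∀ {a b t} → t ≤ a → ramp a b t ≡ 0
  ramp-low {b = b} t≤a = cong (_⊓ b) (m≤n⇒m∸n≡0 t≤a)

  ramp-high : ∀ {a b t} → a + b ≤ t → ramp a b t ≡ b
  ramp-high {a} {b} {t} a+b≤t = m≥n⇒m⊓n≡n (m+n≤o⇒m≤o∸n b (subst (_≤ t) (+-comm a b) a+b≤t))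

  ramp-suc : ∀ a b t → ramp a b (suc t) ≤ suc (ramp a b t)
  ramp-suc a b t = begin
    (suc t ∸ a) ⊓ b           ≤⟨ ⊓-mono-≤ (suc∸ a) (n≤1+n b) ⟩
    suc (t ∸ a) ⊓ suc b       ≡⟨⟩
    suc (ramp a b t)          ∎
    where
    open ≤-Reasoning
    suc∸ : ∀ a → suc t ∸ a ≤ suc (t ∸ a)
    suc∸ a = m≤n+o⇒m∸n≤o (suc t) a (≤-trans (s≤s (m≤n+m∸n t a)) (≤-reflexive (sym (+-suc a (t ∸ a)))))

  ramp-mono : ∀ a b {t t′} → t ≤ t′ → ramp a b t ≤ ramp a b t′
  ramp-mono a b t≤t′ = ⊓-monoˡ-≤ b (∸-monoˡ-≤ a t≤t′)

  n<2⌊n/2⌋+2 : ∀ n → n < 2 + 2 * ⌊ n /2⌋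
  n<2⌊n/2⌋+2 zero          = s≤s z≤n
  n<2⌊n/2⌋+2 (suc zero)    = s≤s (s≤s z≤n)
  n<2⌊n/2⌋+2 (suc (suc n)) = subst (2 + n <_)
    (solve 1 (λ h → con 2 :+ (con 2 :+ con 2 :* h) := con 2 :+ con 2 :* (con 1 :+ h)) refl ⌊ n /2⌋)
    (s≤s (s≤s (n<2⌊n/2⌋+2 n)))
    where open +-*-Solver

  2⌊n/2⌋≤n : ∀ n → 2 * ⌊ n /2⌋ ≤ n
  2⌊n/2⌋≤n zero          = z≤n
  2⌊n/2⌋≤n (suc zero)    = z≤n
  2⌊n/2⌋≤n (suc (suc n)) = subst (_≤ 2 + n)
    (solve 1 (λ h → con 2 :+ con 2 :* h := con 2 :* (con 1 :+ h)) refl ⌊ n /2⌋)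
    (s≤s (s≤s (2⌊n/2⌋≤n n)))
    where open +-*-Solver

-- The corridor graph

module Corridor (m s d : ℕ) where

  open import Data.Fin.Subset using (Subset; _∈_; _-_; ⁅_⁆)
  open import Data.Fin.Subset.Properties using (p─q⊆p; x∈p∧x≢y⇒x∈p-y)
  open import Data.List.Membership.Propositional.Properties using (∈-map⁻)
  open import Data.List.Properties using (map-++; ++-identityʳ; length-map; map-∘; map-cong)
  open import Data.List.Relation.Binary.Permutation.Propositional using (_↭_; ↭-sym; ↭-refl; ↭-trans; ↭-reflexive)
  open import Data.List.Relation.Binary.Permutation.Propositional.Properties using (shift; ++-comm; ++⁺ˡ; map⁺)
  import Data.List.Relation.Unary.All.Properties as All
  import Data.List.Relation.Unary.AllPairs.Properties as AllPairs
  open import Data.Nat using (_+_; _*_; _∸_; _≤_; _<_; _≤?_; _<?_; _≟_; ⌊_/2⌋; _≤′_; ≤′-refl; ≤′-step)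
  open import Data.Nat.ListAction.Properties using (sum-++)
  open import Data.Nat.Properties
  open import Data.Sum.Function.Propositional using (_⊎-↔_)
  open import Function.Construct.Composition using (_↔-∘_)
  open Intervals
  open TokenSets
  open Sides
  open Arithmetic

  -- Each end of the path has `k + k` vertices, enough for all `k` tokens on every second vertex,
  -- and `m` vertices lie between the ends. The other vertices are `s` slots and `s` long intervals
  -- for each side.
  k N n : ℕ
  k = s + s + d
  N = k + k + m + (k + k)
  n = N + ((s + s) + (s + s))

  -- In the intended order long left 0, long right 0, long left 1, long right 1, … of first uses, long σ i
  -- is preceded by i long intervals of its own side and by far σ i of the other side.
  far : Side → ℕ → ℕ
  far left  i = i
  far right i = suc i

  -- The number of tokens for which long σ i leaves room at the opposite end of the path: one token is on
  -- the long interval itself, and i + far σ i are parked.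
  room : Side → ℕ → ℕ
  room σ i = k ∸ suc (i + far σ i)

  data V : Set where
    path : Fin N → V
    slot : Side → Fin s → V
    long : Side → Fin s → V

  slot≢slotᵒ : ∀ σ {i j} → slot σ i ≢ slot (opp σ) j
  slot≢slotᵒ left  ()
  slot≢slotᵒ right ()

  long≢longᵒ : ∀ σ {i j} → long σ i ≢ long (opp σ) j
  long≢longᵒ left  ()
  long≢longᵒ right ()

  pos : Side → Fin N → ℕ
  pos left  x = toℕ x
  pos right x = toℕ (opposite x)

  -- The vertices on either side of `x`, together with `x`, make up the path. The form as a sum
  -- avoids truncated subtraction when changing from one end to the other.
  pos-opp : ∀ σ x → pos σ x + suc (pos (opp σ) x) ≡ N
  pos-opp left x = begin-equality
    toℕ x + suc (toℕ (opposite x))  ≡⟨ +-suc (toℕ x) _ ⟩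
    suc (toℕ x + toℕ (opposite x))  ≡⟨ cong (λ y → suc (toℕ x + y)) (Fin.opposite-prop x) ⟩
    suc (toℕ x) + (N ∸ suc (toℕ x)) ≡⟨ m+[n∸m]≡n (Fin.toℕ<n x) ⟩
    N                               ∎
    where open ≤-Reasoning
  pos-opp right x = trans (trans (+-suc _ _) (trans (cong suc (+-comm (toℕ (opposite x)) (toℕ x))) (sym (+-suc (toℕ x) _))))
                          (pos-opp left x)

  -- Slots are numbered from the outside inwards, on each side.
  data Edge : V → V → Set where
    path-path : ∀ {x y} → suc (toℕ x) ≡ toℕ y → Edge (path x) (path y)
    long-path : ∀ {σ i x} → 2 * room σ (toℕ i) ≤ suc (pos (opp σ) x) → Edge (long σ i) (path x)
    long-slot : ∀ {σ i j} → toℕ i ≤ toℕ j → Edge (long σ i) (slot σ j)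
    long-long : ∀ {σ τ i j} → long σ i ≢ long τ j → Edge (long σ i) (long τ j)

  _≟ˢ_ : (σ τ : Side) → Dec (σ ≡ τ)
  left  ≟ˢ left  = yes refl
  left  ≟ˢ right = no λ ()
  right ≟ˢ left  = no λ ()
  right ≟ˢ right = yes refl

  edge? : ∀ u v → Dec (Edge u v)
  edge? (path x)   (path y)   = map′ path-path (λ { (path-path e) → e }) (suc (toℕ x) ≟ toℕ y)
  edge? (path _)   (slot _ _) = no λ ()
  edge? (path _)   (long _ _) = no λ ()
  edge? (slot _ _) _          = no λ ()
  edge? (long σ i) (path x)   = map′ long-path (λ { (long-path e) → e }) (_ ≤? _)
  edge? (long σ i) (slot τ j) with σ ≟ˢ τ
  ... | yes refl = map′ long-slot (λ { (long-slot e) → e }) (_ ≤? _)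
  ... | no  σ≢τ  = no λ { (long-slot _) → σ≢τ refl }
  edge? (long σ i) (long τ j) with σ ≟ˢ τ | i Fin.≟ j
  ... | yes refl | yes refl = no λ { (long-long ≢) → ≢ refl }
  ... | yes refl | no  i≢j  = yes (long-long λ { refl → i≢j refl })
  ... | no σ≢τ   | _        = yes (long-long λ { refl → σ≢τ refl })

  edge-irrefl : ∀ {v} → ¬ Edge v v
  edge-irrefl (path-path e) = 1+n≢n e
  edge-irrefl (long-long ≢) = ≢ refl

  graph : Graph V
  graph = record
    { Adj    = λ u v → Edge u v ⊎ Edge v u
    ; sym    = swap
    ; irrefl = λ { refl → [ edge-irrefl , edge-irrefl ]′ }
    ; adj?   = λ u v → edge? u v ⊎-dec edge? v u
    }

  -- The interval representation

  lo hi : V → ℕ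
  -- The left slots are the points below `s`, the path covers the stretch from `s` to `s + N`, and
  -- the right slots are points beyond it, counted inwards. Every long interval has the slot of its
  -- own index as one end point.
  lo (path x)       = s + toℕ x
  lo (slot left j)  = toℕ j
  lo (slot right j) = s + N + (s ∸ toℕ j)
  lo (long left i)  = toℕ i
  lo (long right i) = s + 2 * room right (toℕ i)
  hi (path x)       = s + suc (toℕ x)
  hi (slot left j)  = toℕ j
  hi (slot right j) = s + N + (s ∸ toℕ j)
  hi (long left i)  = s + (N ∸ 2 * room left (toℕ i))
  hi (long right i) = s + N + (s ∸ toℕ i)

  -- A point common to all long intervals, which makes them pairwise intersecting: each free end of
  -- the path has fewer than `2 * k` vertices or is cut off exactly there.
  mid : ℕ
  mid = s + 2 * k

  2room≤2k : ∀ σ i → 2 * room σ i ≤ 2 * k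
  2room≤2k σ i = *-monoʳ-≤ 2 (m∸n≤m k (suc (i + far σ i)))

  2k+2k≤N : 2 * k + 2 * k ≤ N
  2k+2k≤N = subst (2 * k + 2 * k ≤_)
    (solve 2 (λ k m → con 2 :* k :+ con 2 :* k :+ m := k :+ k :+ m :+ (k :+ k)) refl k m) (m≤m+n _ m)
    where open +-*-Solver

  mid≤s+N : mid ≤ s + N
  mid≤s+N = +-monoʳ-≤ s (≤-trans (m≤m+n (2 * k) (2 * k)) 2k+2k≤N)

  lo-long≤mid : ∀ σ i → lo (long σ i) ≤ mid
  lo-long≤mid left  i = ≤-trans (<⇒≤ (Fin.toℕ<n i)) (m≤m+n s _)
  lo-long≤mid right i = +-monoʳ-≤ s (2room≤2k right (toℕ i))

  mid≤hi-long : ∀ σ i → mid ≤ hi (long σ i)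
  mid≤hi-long left i = +-monoʳ-≤ s (m+n≤o⇒m≤o∸n (2 * k) (≤-trans (+-monoʳ-≤ (2 * k) (2room≤2k left (toℕ i))) 2k+2k≤N))
  mid≤hi-long right i = ≤-trans mid≤s+N (m≤m+n (s + N) _)

  lo≤hi : ∀ v → lo v ≤ hi v
  lo≤hi (path x)       = +-monoʳ-≤ s (n≤1+n _)
  lo≤hi (slot left j)  = ≤-refl
  lo≤hi (slot right j) = ≤-refl
  lo≤hi (long σ i)     = ≤-trans (lo-long≤mid σ i) (mid≤hi-long σ i)

  edge-overlaps : ∀ {u v} → Edge u v → lo u ≤ hi v × lo v ≤ hi u
  edge-overlaps (path-path {x} {y} e) = +-monoʳ-≤ s (≤-trans (n≤1+n _) (≤-trans (≤-reflexive e) (n≤1+n _)))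
                                      , +-monoʳ-≤ s (≤-reflexive (sym e))
  edge-overlaps (long-path {left} {i} {x} e) = ≤-trans (<⇒≤ (Fin.toℕ<n i)) (m≤m+n s _)
    , +-monoʳ-≤ s (m+n≤o⇒m≤o∸n (toℕ x) (subst (toℕ x + 2 * room left (toℕ i) ≤_) (pos-opp left x) (+-monoʳ-≤ (toℕ x) e)))
  edge-overlaps (long-path {right} {i} {x} e) = +-monoʳ-≤ s e
    , ≤-trans (+-monoʳ-≤ s (<⇒≤ (Fin.toℕ<n x))) (m≤m+n (s + N) _)
  edge-overlaps (long-slot {left} {i} {j} i≤j) = i≤j , ≤-trans (<⇒≤ (Fin.toℕ<n j)) (m≤m+n s _)
  edge-overlaps (long-slot {right} {i} {j} i≤j) =
      ≤-trans (lo-long≤mid right i) (≤-trans mid≤s+N (m≤m+n (s + N) _))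
    , +-monoʳ-≤ (s + N) (∸-monoʳ-≤ s i≤j)
  edge-overlaps (long-long {σ} {τ} {i} {j} _) = ≤-trans (lo-long≤mid σ i) (mid≤hi-long τ j)
                                              , ≤-trans (lo-long≤mid τ j) (mid≤hi-long σ i)

  overlaps : ∀ {u v} → Graph.Adj graph u v → lo u ≤ hi v
  overlaps = [ proj₁ ∘ edge-overlaps , proj₂ ∘ edge-overlaps ]′

  Separate : V → V → Set
  Separate u v = hi u < lo v ⊎ hi v < lo u

  ≢⇒<⊎> : ∀ {a b} → a ≢ b → a < b ⊎ b < a
  ≢⇒<⊎> a≢b = [ (λ a≤b → inj₁ (≤∧≢⇒< a≤b a≢b)) , (λ b≤a → inj₂ (≤∧≢⇒< b≤a (a≢b ∘ sym))) ]′ (≤-total _ _)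

  s+N<slot : ∀ (j : Fin s) → s + N < s + N + (s ∸ toℕ j)
  s+N<slot j = m<m+n (s + N) (m<n⇒0<n∸m (Fin.toℕ<n j))

  separate-path-path : ∀ x y → x ≢ y → ¬ Edge (path x) (path y) → ¬ Edge (path y) (path x) → Separate (path x) (path y)
  separate-path-path x y x≢y ¬xy ¬yx with ≢⇒<⊎> (x≢y ∘ Fin.toℕ-injective)
  ... | inj₁ x<y = inj₁ (+-monoʳ-< s (≤∧≢⇒< x<y (¬xy ∘ path-path)))
  ... | inj₂ y<x = inj₂ (+-monoʳ-< s (≤∧≢⇒< y<x (¬yx ∘ path-path)))

  separate-path-slot : ∀ x σ j → Separate (path x) (slot σ j)
  separate-path-slot x left  j = inj₂ (≤-trans (Fin.toℕ<n j) (m≤m+n s _))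
  separate-path-slot x right j = inj₁ (≤-<-trans (+-monoʳ-≤ s (Fin.toℕ<n x)) (s+N<slot j))

  separate-long-path : ∀ σ i x → ¬ Edge (long σ i) (path x) → Separate (long σ i) (path x)
  separate-long-path left i x ¬e = inj₁ (+-monoʳ-< s (+-cancelʳ-< (2 * c) (N ∸ 2 * c) (toℕ x) (begin-strict
    N ∸ 2 * c + 2 * c                ≡⟨ m∸n+n≡m (≤-trans (2room≤2k left (toℕ i)) (≤-trans (m≤m+n (2 * k) (2 * k)) 2k+2k≤N)) ⟩
    N                                ≡⟨ pos-opp left x ⟨
    toℕ x + suc (pos right x)        <⟨ +-monoʳ-< (toℕ x) (≰⇒> (¬e ∘ long-path)) ⟩
    toℕ x + 2 * c                    ∎)))
    where
    open ≤-Reasoning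
    c = room left (toℕ i)
  separate-long-path right i x ¬e = inj₂ (+-monoʳ-< s (≰⇒> (¬e ∘ long-path)))

  separate-slot-slot : ∀ σ i τ j → slot σ i ≢ slot τ j → Separate (slot σ i) (slot τ j)
  separate-slot-slot left  i left  j ≢ = ≢⇒<⊎> λ e → ≢ (cong (slot left) (Fin.toℕ-injective e))
  separate-slot-slot left  i right j ≢ = inj₁ (<-≤-trans (Fin.toℕ<n i) (≤-trans (m≤m+n s N) (m≤m+n (s + N) _)))
  separate-slot-slot right i left  j ≢ = inj₂ (<-≤-trans (Fin.toℕ<n j) (≤-trans (m≤m+n s N) (m≤m+n (s + N) _)))
  separate-slot-slot right i right j ≢ with ≢⇒<⊎> (λ e → ≢ (cong (slot right) (Fin.toℕ-injective e)))
  ... | inj₁ i<j = inj₂ (+-monoʳ-< (s + N) (∸-monoʳ-< i<j (<⇒≤ (Fin.toℕ<n j))))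
  ... | inj₂ j<i = inj₁ (+-monoʳ-< (s + N) (∸-monoʳ-< j<i (<⇒≤ (Fin.toℕ<n i))))

  separate-long-slot : ∀ σ i τ j → ¬ Edge (long σ i) (slot τ j) → Separate (long σ i) (slot τ j)
  separate-long-slot left  i left  j ¬e = inj₂ (≰⇒> (¬e ∘ long-slot))
  separate-long-slot left  i right j ¬e = inj₁ (≤-<-trans (+-monoʳ-≤ s (m∸n≤m N (2 * room left (toℕ i)))) (s+N<slot j))
  separate-long-slot right i left  j ¬e = inj₂ (<-≤-trans (Fin.toℕ<n j) (m≤m+n s _))
  separate-long-slot right i right j ¬e = inj₁ (+-monoʳ-< (s + N) (∸-monoʳ-< (≰⇒> (¬e ∘ long-slot)) (<⇒≤ (Fin.toℕ<n i))))

  separate : ∀ {u v} → u ≢ v → ¬ Graph.Adj graph u v → Separate u v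
  separate {path x}   {path y}   u≢v ¬uv = separate-path-path x y (λ { refl → u≢v refl }) (¬uv ∘ inj₁) (¬uv ∘ inj₂)
  separate {path x}   {slot σ j} u≢v ¬uv = separate-path-slot x σ j
  separate {path x}   {long σ i} u≢v ¬uv = swap (separate-long-path σ i x (¬uv ∘ inj₂))
  separate {slot σ j} {path x}   u≢v ¬uv = swap (separate-path-slot x σ j)
  separate {slot σ i} {slot τ j} u≢v ¬uv = separate-slot-slot σ i τ j u≢v
  separate {slot σ j} {long τ i} u≢v ¬uv = swap (separate-long-slot τ i σ j (¬uv ∘ inj₂))
  separate {long σ i} {path x}   u≢v ¬uv = separate-long-path σ i x (¬uv ∘ inj₁)
  separate {long σ i} {slot τ j} u≢v ¬uv = separate-long-slot σ i τ j (¬uv ∘ inj₁)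
  separate {long σ i} {long τ j} u≢v ¬uv = contradiction (inj₁ (long-long u≢v)) ¬uv

  -- Numbering the vertices

  Fin↔V : Fin n ↔ V
  Fin↔V = mk↔ₛ′ to from
      (λ { (path _) → refl ; (slot left _) → refl ; (slot right _) → refl ; (long left _) → refl ; (long right _) → refl })
      (λ { (inj₁ _) → refl ; (inj₂ (inj₁ (inj₁ _))) → refl ; (inj₂ (inj₁ (inj₂ _))) → refl
         ; (inj₂ (inj₂ (inj₁ _))) → refl ; (inj₂ (inj₂ (inj₂ _))) → refl })
    ↔-∘ ((id ⊎-↔ ((Fin.+↔⊎ ⊎-↔ Fin.+↔⊎) ↔-∘ Fin.+↔⊎)) ↔-∘ Fin.+↔⊎)
    where
    id = mk↔ₛ′ (λ x → x) (λ x → x) (λ _ → refl) (λ _ → refl)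
    to : Fin N ⊎ ((Fin s ⊎ Fin s) ⊎ (Fin s ⊎ Fin s)) → V
    to = [ path , [ [ slot left , slot right ]′ , [ long left , long right ]′ ]′ ]′
    from : V → Fin N ⊎ ((Fin s ⊎ Fin s) ⊎ (Fin s ⊎ Fin s))
    from (path x)       = inj₁ x
    from (slot left j)  = inj₂ (inj₁ (inj₁ j))
    from (slot right j) = inj₂ (inj₁ (inj₂ j))
    from (long left i)  = inj₂ (inj₂ (inj₁ i))
    from (long right i) = inj₂ (inj₂ (inj₂ i))

  decode : Fin n → V
  decode = Inverse.to Fin↔V

  encode : V → Fin n
  encode = Inverse.from Fin↔V

  decode-encode : ∀ v → decode (encode v) ≡ v
  decode-encode = Inverse.strictlyInverseˡ Fin↔V

  decode-injective : ∀ {u v} → decode u ≡ decode v → u ≡ v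
  decode-injective {u} {v} eq = trans (sym (Inverse.strictlyInverseʳ Fin↔V u))
    (trans (cong encode eq) (Inverse.strictlyInverseʳ Fin↔V v))

  G : Graph (Fin n)
  G = record
    { Adj    = λ u v → Graph.Adj graph (decode u) (decode v)
    ; sym    = swap
    ; irrefl = λ { refl → Graph.irrefl graph refl }
    ; adj?   = λ u v → Graph.adj? graph (decode u) (decode v)
    }

  isIntervalGraph-G : IsIntervalGraph G
  isIntervalGraph-G = isIntervalGraph G (lo ∘ decode) (hi ∘ decode) (lo≤hi ∘ decode) overlaps
    (λ u≢v → separate (u≢v ∘ decode-injective))

  -- The order of openings, token weights and cells

  far-cancel : ∀ σ {a b} → far σ a ≤ far σ b → a ≤ b
  far-cancel left  a≤b       = a≤b
  far-cancel right (s≤s a≤b) = a≤b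

  -- Maintains the alternation: once `long σ i` is open, the next interval in the intended order is
  -- `long (opp σ) j`.
  far-swap : ∀ σ {i j} → j ≡ far σ i → suc i ≡ far (opp σ) j
  far-swap left  refl = refl
  far-swap right refl = refl

  -- The subtraction in `room` is never truncated: the tokens subtracted number at most `s + s`,
  -- even on the right.
  room+ : ∀ σ {a} → a < s → room σ a + suc (a + far σ a) ≡ k
  room+ σ {a} a<s = m∸n+n≡m (begin
    suc (a + far σ a)   ≤⟨ s≤s (+-monoʳ-≤ a (far≤ σ)) ⟩
    suc a + suc a       ≤⟨ +-mono-≤ a<s a<s ⟩
    s + s               ≤⟨ m≤m+n (s + s) d ⟩
    k                   ∎)
    where
    open ≤-Reasoning
    far≤ : ∀ σ → far σ a ≤ suc a
    far≤ left  = n≤1+n a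
    far≤ right = ≤-refl

  -- Where the other tokens can be while one is on `long σ i`. No long interval occurs here, as any
  -- two of them are adjacent.
  data Avoids (σ : Side) (i : ℕ) : V → Set where
    near   : ∀ {j} → toℕ j < i → Avoids σ i (slot σ j)
    beyond : ∀ {x} → suc (pos (opp σ) x) < 2 * room σ i → Avoids σ i (path x)
    across : ∀ {j} → Avoids σ i (slot (opp σ) j)

  avoids : ∀ {σ i v} → long σ i ≢ v → ¬ Graph.Adj graph (long σ i) v → Avoids σ (toℕ i) v
  avoids {v = path x}   _ ¬adj = beyond (≰⇒> (¬adj ∘ inj₁ ∘ long-path))
  avoids {v = long τ j} ≢ ¬adj = contradiction (inj₁ (long-long ≢)) ¬adj
  avoids {σ} {v = slot τ j} _ ¬adj with same-or-opp σ τ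
  ... | inj₁ refl = near (≰⇒> (¬adj ∘ inj₁ ∘ long-slot))
  ... | inj₂ refl = across

  -- A parked token weighs as much as one packed at the end of the path next to its slot.
  offset : Side → Side → ℕ
  offset left  left  = 0
  offset left  right = m
  offset right left  = m
  offset right right = 0

  offset-same : ∀ σ → offset σ σ ≡ 0
  offset-same left  = refl
  offset-same right = refl

  offset-opp : ∀ σ → offset σ (opp σ) ≡ m
  offset-opp left  = refl
  offset-opp right = refl

  -- A token walking from the end σ of the path to the other end gains weight only on the middle part, so
  -- that tokens packed at an end weigh 0 or m each.
  ω : Side → V → ℕ
  ω σ (path x)   = ramp (2 * k) m (pos σ x)
  ω σ (slot τ _) = offset σ τ
  ω σ (long _ _) = 0

  ω≤m : ∀ σ v → ω σ v ≤ m
  ω≤m σ     (path x)       = m⊓n≤n _ m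
  ω≤m left  (slot left _)  = z≤n
  ω≤m left  (slot right _) = ≤-refl
  ω≤m right (slot left _)  = ≤-refl
  ω≤m right (slot right _) = z≤n
  ω≤m σ     (long _ _)     = z≤n

  slotCell : Side → V → Maybe ℕ
  slotCell left  (slot left  j) = just (toℕ j)
  slotCell right (slot right j) = just (toℕ j)
  slotCell _     _              = nothing

  slotCell-same : ∀ σ j → slotCell σ (slot σ j) ≡ just (toℕ j)
  slotCell-same left  j = refl
  slotCell-same right j = refl

  slotCell-view : ∀ σ v {a} → slotCell σ v ≡ just a → ∃ λ j → v ≡ slot σ j × toℕ j ≡ a
  slotCell-view left  (slot left  j) refl = j , refl , refl
  slotCell-view right (slot right j) refl = j , refl , refl

  -- Consecutive vertices of the path are paired, starting from the end `σ`. The two vertices of a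
  -- pair are adjacent, so independent tokens occupy distinct cells.
  pathCell : Side → V → Maybe ℕ
  pathCell σ (path x) = just ⌊ pos σ x /2⌋
  pathCell σ _        = nothing

  pathCell-view : ∀ σ v {a} → pathCell σ v ≡ just a → ∃ λ x → v ≡ path x × ⌊ pos σ x /2⌋ ≡ a
  pathCell-view σ (path x) refl = x , refl , refl

  #slots : Side → Subset n → ℕ
  #slots σ = count (slotCell σ ∘ decode)

  total : Side → Subset n → ℕ
  total σ = weigh (ω σ ∘ decode)

  path-adj : ∀ σ {x y} → suc (pos σ x) ≡ pos σ y → Graph.Adj graph (path x) (path y)
  path-adj left  e = inj₁ (path-path e)
  path-adj right {x} {y} e = inj₂ (path-path (suc-injective (+-cancelˡ-≡ (toℕ (opposite x)) _ _ (begin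
    toℕ (opposite x) + suc (suc (toℕ y))   ≡⟨ +-suc _ _ ⟩
    suc (toℕ (opposite x)) + suc (toℕ y)   ≡⟨ cong (_+ suc (toℕ y)) e ⟩
    toℕ (opposite y) + suc (toℕ y)         ≡⟨ pos-opp right y ⟩
    N                                      ≡⟨ pos-opp right x ⟨
    toℕ (opposite x) + suc (toℕ x)         ∎))))
    where open ≡-Reasoning

  path-pos : ∀ σ {x y} → suc (toℕ x) ≡ toℕ y → pos σ x ≤ suc (pos σ y) × pos σ y ≤ suc (pos σ x)
  path-pos left  {x} {y} e = ≤-trans (n≤1+n _) (≤-trans (≤-reflexive e) (n≤1+n _)) , ≤-reflexive (sym e)
  path-pos right {x} {y} e = ≤-reflexive eq , ≤-trans (n≤1+n _) (≤-trans (≤-reflexive (sym eq)) (n≤1+n _))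
    where
    eq : toℕ (opposite x) ≡ suc (toℕ (opposite y))
    eq = +-cancelʳ-≡ (suc (toℕ x)) _ _ (begin
      toℕ (opposite x) + suc (toℕ x)         ≡⟨ pos-opp right x ⟩
      N                                      ≡⟨ pos-opp right y ⟨
      toℕ (opposite y) + suc (toℕ y)         ≡⟨ +-suc _ _ ⟩
      suc (toℕ (opposite y)) + toℕ y         ≡⟨ cong (suc (toℕ (opposite y)) +_) e ⟨
      suc (toℕ (opposite y)) + suc (toℕ x)   ∎)
      where open ≡-Reasoning

  pos-injective : ∀ σ {x y} → pos σ x ≡ pos σ y → x ≡ y
  pos-injective left  e = Fin.toℕ-injective e
  pos-injective right e = trans (sym (Fin.opposite-involutive _))
    (trans (cong opposite (Fin.toℕ-injective e)) (Fin.opposite-involutive _))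

  -- Positions with equal halves differ by at most one, and two that differ by one belong to
  -- adjacent vertices.
  same-pathCell : ∀ σ x y → pos σ x ≤ pos σ y → ⌊ pos σ x /2⌋ ≡ ⌊ pos σ y /2⌋ →
                  ¬ Graph.Adj graph (path x) (path y) → x ≡ y
  same-pathCell σ x y x≤y half ¬xy = pos-injective σ (≤-antisym x≤y (≮⇒≥ λ x<y →
    ¬xy (path-adj σ (≤-antisym x<y (≤-pred (begin
      suc (pos σ y)                     ≤⟨ n<2⌊n/2⌋+2 _ ⟩
      2 + 2 * ⌊ pos σ y /2⌋             ≡⟨ cong (λ h → 2 + 2 * h) half ⟨
      2 + 2 * ⌊ pos σ x /2⌋             ≤⟨ +-monoʳ-≤ 2 (2⌊n/2⌋≤n _) ⟩
      2 + pos σ x                       ∎))))))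
    where open ≤-Reasoning

  -- The last `2 * k` vertices seen from `σ` come after the first `2 * k` and the `m` middle ones,
  -- so the ramp is complete there.
  weight≡m : ∀ σ x → suc (pos (opp σ) x) ≤ 2 * k → ω σ (path x) ≡ m
  weight≡m σ x le = ramp-high {2 * k} (+-cancelʳ-≤ (2 * k) (2 * k + m) (pos σ x) (begin
    2 * k + m + 2 * k            ≡⟨ solve 2 (λ k m → con 2 :* k :+ m :+ con 2 :* k := k :+ k :+ m :+ (k :+ k)) refl k m ⟩
    N                            ≡⟨ pos-opp σ x ⟨
    pos σ x + suc (pos (opp σ) x) ≤⟨ +-monoʳ-≤ (pos σ x) le ⟩
    pos σ x + 2 * k              ∎))
    where
    open ≤-Reasoning
    open +-*-Solver

  beyond⇒high : ∀ {σ i} x → suc (pos (opp σ) x) < 2 * room σ i → ω σ (path x) ≡ m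
  beyond⇒high {σ} {i} x lt = weight≡m σ x (≤-trans (<⇒≤ lt) (2room≤2k σ i))

  beyond⇒low : ∀ {σ i} x → suc (pos (opp σ) x) < 2 * room σ i → ω (opp σ) (path x) ≡ 0
  beyond⇒low {σ} {i} x lt = ramp-low (≤-trans (n≤1+n _) (≤-trans (<⇒≤ lt) (2room≤2k σ i)))

  -- Counting the tokens next to an occupied long interval

  module Hole (C : Subset n) (independent-C : Independent G C) {σ i}
              (avoiding : ∀ {v} → v ∈ C → Avoids σ i (decode v)) where

    #slots≤ : #slots σ C ≤ i
    #slots≤ = count-≤ _ i C (bounded ∘ avoiding) distinct
      where
      bounded : ∀ {v j} → Avoids σ i v → slotCell σ v ≡ just j → j < i
      bounded (near {j} j<i) eq with refl ← trans (sym (slotCell-same σ j)) eq = j<i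
      bounded (beyond _) eq with _ , () , _ ← slotCell-view σ _ eq
      bounded across eq with _ , e , _ ← slotCell-view σ _ eq = contradiction (sym e) (slot≢slotᵒ σ)
      distinct : ∀ {u v j} → u ∈ C → v ∈ C →
                 slotCell σ (decode u) ≡ just j → slotCell σ (decode v) ≡ just j → u ≡ v
      distinct {u} {v} _ _ equ eqv
        with _ , eu , refl ← slotCell-view σ (decode u) equ | _ , ev , e ← slotCell-view σ (decode v) eqv =
        decode-injective (trans eu (trans (cong (slot σ) (sym (Fin.toℕ-injective e))) (sym ev)))

    -- The free end consists of the positions up to `2 * room σ i - 2` seen from the opposite side.
    -- These meet only the first `room σ i` pairs, each of which holds at most one token.
    #paths≤ : count (pathCell (opp σ) ∘ decode) C ≤ room σ i
    #paths≤ = count-≤ _ (room σ i) C (bounded ∘ avoiding) distinct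
      where
      bounded : ∀ {v j} → Avoids σ i v → pathCell (opp σ) v ≡ just j → j < room σ i
      bounded (beyond lt) refl = *-cancelˡ-< 2 _ _ (≤-<-trans (2⌊n/2⌋≤n _) (≤-<-trans (n≤1+n _) lt))
      distinct : ∀ {u v j} → u ∈ C → v ∈ C →
                 pathCell (opp σ) (decode u) ≡ just j → pathCell (opp σ) (decode v) ≡ just j → u ≡ v
      distinct {u} {v} u∈C v∈C equ eqv
        with x , eu , ex ← pathCell-view (opp σ) (decode u) equ | y , ev , ey ← pathCell-view (opp σ) (decode v) eqv =
        decode-injective (trans eu (trans (cong path x≡y) (sym ev)))
        where
        ¬xy : ¬ Graph.Adj graph (path x) (path y)
        ¬xy xy = independent-C u v u∈C v∈C
          (subst (λ w → Graph.Adj graph w (decode v)) (sym eu) (subst (Graph.Adj graph (path x)) (sym ev) xy))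
        x≡y : x ≡ y
        x≡y = [ (λ x≤y → same-pathCell (opp σ) x y x≤y (trans ex (sym ey)) ¬xy)
              , (λ y≤x → sym (same-pathCell (opp σ) y x y≤x (trans ey (sym ex)) (¬xy ∘ swap))) ]′ (≤-total _ _)

    -- Seen from `σ`, a token of `C` is either in a near slot or already past the middle with full
    -- weight `m`. Summing this alternative over `C` gives the bound.
    total-same≥ : m * weigh (λ _ → 1) C ≤ total σ C + m * #slots σ C
    total-same≥ = begin
      m * weigh (λ _ → 1) C                                          ≡⟨ weigh-* m _ C ⟨
      weigh (λ _ → m * 1) C                                          ≤⟨ weigh-mono C (pointwise ∘ avoiding) ⟩
      weigh (λ v → ω σ (decode v) + m * indicator (slotCell σ (decode v))) C ≡⟨ weigh-+ _ _ C ⟩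
      total σ C + weigh (λ v → m * indicator (slotCell σ (decode v))) C ≡⟨ cong (total σ C +_) (weigh-* m _ C) ⟩
      total σ C + m * #slots σ C                                     ∎
      where
      open ≤-Reasoning
      pointwise : ∀ {v} → Avoids σ i v → m * 1 ≤ ω σ v + m * indicator (slotCell σ v)
      pointwise (near {j} _) rewrite slotCell-same σ j = m≤n+m (m * 1) _
      pointwise (beyond {x} lt) rewrite beyond⇒high {σ} {i} x lt = ≤-trans (≤-reflexive (*-identityʳ m)) (m≤m+n m _)
      pointwise (across {j}) rewrite offset-opp σ = ≤-trans (≤-reflexive (*-identityʳ m)) (m≤m+n m _)

    -- Seen from the opposite side, the free end and the slots across have weight `0`, so only
    -- tokens in near slots contribute.
    total-opp≤ : total (opp σ) C ≤ m * #slots σ C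
    total-opp≤ = ≤-trans (weigh-mono C (pointwise ∘ avoiding)) (≤-reflexive (weigh-* m _ C))
      where
      pointwise : ∀ {v} → Avoids σ i v → ω (opp σ) v ≤ m * indicator (slotCell σ v)
      pointwise (near {j} _) rewrite slotCell-same σ j =
        ≤-trans (ω≤m (opp σ) (slot σ j)) (≤-reflexive (sym (*-identityʳ m)))
      pointwise (beyond {x} lt) rewrite beyond⇒low {σ} {i} x lt = z≤n
      pointwise (across {j}) rewrite offset-same (opp σ) = z≤n

    -- Near slots, the free end and the slots across are the only places left, and the first two
    -- hold at most `i` and `room σ i` tokens.
    capacity : weigh (λ _ → 1) C ≤ i + (room σ i + #slots (opp σ) C)
    capacity = begin
      weigh (λ _ → 1) C       ≤⟨ weigh-mono C (pointwise ∘ avoiding) ⟩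
      weigh (λ v → indicator (slotCell σ (decode v)) +
                   (indicator (pathCell (opp σ) (decode v)) + indicator (slotCell (opp σ) (decode v)))) C
                              ≡⟨ weigh-+ _ _ C ⟩
      #slots σ C + weigh (λ v → indicator (pathCell (opp σ) (decode v)) + indicator (slotCell (opp σ) (decode v))) C
                              ≡⟨ cong (#slots σ C +_) (weigh-+ _ _ C) ⟩
      #slots σ C + (count (pathCell (opp σ) ∘ decode) C + #slots (opp σ) C)
                              ≤⟨ +-mono-≤ #slots≤ (+-monoˡ-≤ _ #paths≤) ⟩
      i + (room σ i + #slots (opp σ) C) ∎
      where
      open ≤-Reasoning
      pointwise : ∀ {v} → Avoids σ i v →
                  1 ≤ indicator (slotCell σ v) + (indicator (pathCell (opp σ) v) + indicator (slotCell (opp σ) v))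
      pointwise (near {j} _) rewrite slotCell-same σ j = s≤s z≤n
      pointwise (beyond {x} lt) = m≤n⇒m≤o+n (indicator (slotCell σ (path x))) (s≤s z≤n)
      pointwise (across {j}) rewrite slotCell-same (opp σ) j = m≤n+m 1 _

  -- In a stage with direction σ the long intervals used so far are the first i on the side σ and the first j
  -- on the other side, and the middle tokens are on their way away from the side σ.
  record Stage (σ : Side) (i j moves : ℕ) (S : Subset n) : Set where
    field
      j≡far      : j ≡ far σ i
      i≤s        : i ≤ s
      j≤s        : j ≤ s
      #slots≤    : #slots σ S ≤ i
      #slotsᵒ≤   : #slots (opp σ) S ≤ j
      long<      : ∀ {v a} → v ∈ S → decode v ≡ long σ a → toℕ a < i
      longᵒ<     : ∀ {v a} → v ∈ S → decode v ≡ long (opp σ) a → toℕ a < j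
      cost       : (i + j) * (d * m) + ramp (s * m) (d * m) (total σ S) ≤ moves

  -- The effect of one move

  module Move {S S′ : Subset n} (ind : Independent G S) (ind′ : Independent G S′) (size : weigh (λ _ → 1) S ≡ k)
              {u v} (u∈S : u ∈ S) (v∈S′ : v ∈ S′) (uv : Graph.Adj G u v) (rest≡ : S - u ≡ S′ - v) where

    C : Subset n
    C = S - u

    C⊆S : ∀ {w} → w ∈ C → w ∈ S
    C⊆S = p─q⊆p S ⁅ u ⁆

    C⊆S′ : ∀ {w} → w ∈ C → w ∈ S′
    C⊆S′ w∈C = p─q⊆p S′ ⁅ v ⁆ (subst (_ ∈_) rest≡ w∈C)

    independent-C : Independent G C
    independent-C x y x∈C y∈C = ind x y (C⊆S x∈C) (C⊆S y∈C)

    weigh-S : ∀ f → weigh f S ≡ f u + weigh f C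
    weigh-S f = weigh-remove f u∈S

    weigh-S′ : ∀ f → weigh f S′ ≡ f v + weigh f C
    weigh-S′ f = trans (weigh-remove f v∈S′) (cong (λ D → f v + weigh f D) (sym rest≡))

    size-C : suc (weigh (λ _ → 1) C) ≡ k
    size-C = trans (sym (weigh-S _)) size

    Involves : Side → Fin s → Set
    Involves τ a = decode u ≡ long τ a ⊎ decode v ≡ long τ a

    -- The tokens at rest are independent of `u` before the move and of `v` after it, so it does not
    -- matter which end of the move is the long interval.
    avoiding : ∀ {τ a} → Involves τ a → ∀ {w} → w ∈ C → Avoids τ (toℕ a) (decode w)
    avoiding (inj₁ e) {w} w∈C = avoids (λ e′ → x∈p-y⇒x≢y S w∈C (sym (decode-injective (trans e e′))))
      (subst (λ z → ¬ Graph.Adj graph z (decode w)) e (ind u w u∈S (C⊆S w∈C)))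
    avoiding (inj₂ e) {w} w∈C = avoids
      (λ e′ → x∈p-y⇒x≢y S′ (subst (w ∈_) rest≡ w∈C) (sym (decode-injective (trans e e′))))
      (subst (λ z → ¬ Graph.Adj graph z (decode w)) e (ind′ v w v∈S′ (C⊆S′ w∈C)))

    module HoleAt {τ a} (inv : Involves τ a) = Hole C independent-C {τ} {toℕ a} (avoiding inv)

    -- Fewer than `s` of the `k - 1` tokens at rest are in near slots. Hence at least `k - s`, that
    -- is `s + d`, of them have weight `m`.
    total-same : ∀ {τ a} → Involves τ a → s * m + d * m ≤ total τ C
    total-same {τ} {a} inv = +-cancelʳ-≤ (m * s) _ _ (begin
      s * m + d * m + m * s                        ≡⟨ solve 3
        (λ s d m → s :* m :+ d :* m :+ m :* s := m :* (s :+ s :+ d)) refl s d m ⟩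
      m * k                                        ≡⟨ cong (m *_) size-C ⟨
      m * suc (weigh (λ _ → 1) C)                  ≡⟨ *-suc m _ ⟩
      m + m * weigh (λ _ → 1) C                    ≤⟨ +-monoʳ-≤ m (HoleAt.total-same≥ inv) ⟩
      m + (total τ C + m * #slots τ C)             ≡⟨ solve 3
        (λ m t c → m :+ (t :+ m :* c) := t :+ m :* (con 1 :+ c)) refl m (total τ C) (#slots τ C) ⟩
      total τ C + m * suc (#slots τ C)             ≤⟨ +-monoʳ-≤ (total τ C)
        (*-monoʳ-≤ m (≤-<-trans (HoleAt.#slots≤ inv) (Fin.toℕ<n a))) ⟩
      total τ C + m * s                            ∎)
      where
      open ≤-Reasoning
      open +-*-Solver

    -- At most `toℕ a` tokens at rest have any weight, and `toℕ a + 1` is at most `s`. The extra `m`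
    -- on the left accounts for the moving token, whatever its position.
    total-opp : ∀ {τ a} → Involves τ a → m + total (opp τ) C ≤ s * m
    total-opp {τ} {a} inv = begin
      m + total (opp τ) C       ≤⟨ +-monoʳ-≤ m (HoleAt.total-opp≤ inv) ⟩
      m + m * #slots τ C        ≡⟨ *-suc m _ ⟨
      m * suc (#slots τ C)      ≤⟨ *-monoʳ-≤ m (≤-<-trans (HoleAt.#slots≤ inv) (Fin.toℕ<n a)) ⟩
      m * s                     ≡⟨ *-comm m s ⟩
      s * m                     ∎
      where open ≤-Reasoning

    -- Only room for k − 1 − i − far τ i tokens is left on the path, so the others must be in the far slots.
    far-bound : ∀ {τ a} → Involves τ a → far τ (toℕ a) ≤ #slots (opp τ) C
    far-bound {τ} {a} inv = +-cancelˡ-≤ (r + suc i) _ _ (begin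
      r + suc i + far τ i                  ≡⟨ solve 3
        (λ r i f → r :+ (con 1 :+ i) :+ f := r :+ (con 1 :+ (i :+ f))) refl r i (far τ i) ⟩
      r + suc (i + far τ i)                ≡⟨ room+ τ (Fin.toℕ<n a) ⟩
      k                                    ≡⟨ size-C ⟨
      suc (weigh (λ _ → 1) C)              ≤⟨ s≤s (HoleAt.capacity inv) ⟩
      suc (i + (r + #slots (opp τ) C))     ≡⟨ solve 3
        (λ r i f → con 1 :+ (i :+ (r :+ f)) := r :+ (con 1 :+ i) :+ f) refl r i (#slots (opp τ) C) ⟩
      r + suc i + #slots (opp τ) C         ∎)
      where
      open ≤-Reasoning
      open +-*-Solver
      i = toℕ a
      r = room τ (toℕ a)

    #slots-C≤ : ∀ τ → #slots τ C ≤ #slots τ S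
    #slots-C≤ τ = subst (#slots τ C ≤_) (sym (weigh-S _)) (m≤n+m _ _)

    -- A slot is entered only from a long interval of its own side. If that is `long τ a`, the
    -- tokens at rest fill at most `toℕ a` slots there, and the entering token adds one.
    #slots-step : ∀ τ → #slots τ S′ ≤ #slots τ S ⊎ ∃ λ a → decode u ≡ long τ a × #slots τ S′ ≤ suc (toℕ a)
    #slots-step τ with slotCell τ (decode v) in eq
    ... | nothing = inj₁ (subst (_≤ #slots τ S)
                           (sym (trans (weigh-S′ _) (cong (λ c → indicator c + #slots τ C) eq))) (#slots-C≤ τ))
    ... | just b = inj₂ (entered (slotCell-view τ _ eq) uv)
      where
      enter : ∀ {a} → Involves τ a → #slots τ S′ ≤ suc (toℕ a)
      enter inv = ≤-trans (≤-reflexive (trans (weigh-S′ _) (cong (λ c → indicator c + #slots τ C) eq)))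
                          (s≤s (HoleAt.#slots≤ inv))
      entered : (∃ λ j → decode v ≡ slot τ j × toℕ j ≡ b) → Graph.Adj G u v →
                ∃ λ a → decode u ≡ long τ a × #slots τ S′ ≤ suc (toℕ a)
      entered (j , ev , _) uv = via (decode u) refl (subst (Graph.Adj graph (decode u)) ev uv)
        where
        via : ∀ w → decode u ≡ w → Graph.Adj graph w (slot τ j) →
              ∃ λ a → decode u ≡ long τ a × #slots τ S′ ≤ suc (toℕ a)
        via _ eu (inj₁ (long-slot {i = a} _)) = a , eu , enter (inj₁ eu)

    ramp-S : Side → Subset n → ℕ
    ramp-S σ T = ramp (s * m) (d * m) (total σ T)

    ramp-full : ∀ {σ T} → total σ C ≤ total σ T → ∀ {a} → Involves σ a → ramp-S σ T ≡ d * m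
    ramp-full C≤T inv = ramp-high (≤-trans (total-same inv) C≤T)

    total-C≤S : ∀ σ → total σ C ≤ total σ S
    total-C≤S σ = subst (total σ C ≤_) (sym (weigh-S _)) (m≤n+m _ _)

    ramp-empty : ∀ {σ a} → Involves (opp σ) a → ramp-S σ S′ ≡ 0
    ramp-empty {σ} inv = ramp-low (begin
      total σ S′                        ≡⟨ weigh-S′ _ ⟩
      ω σ (decode v) + total σ C        ≤⟨ +-monoˡ-≤ (total σ C) (ω≤m σ (decode v)) ⟩
      m + total σ C                     ≤⟨ subst (λ τ → m + total τ C ≤ s * m) (opp-involutive σ) (total-opp inv) ⟩
      s * m                             ∎)
      where open ≤-Reasoning

    -- A token on a long interval may jump across the corridor, but then the total displacement is cut off.
    ramp-involved : ∀ σ {τ a} → Involves τ a → ramp-S σ S′ ≤ ramp-S σ S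
    ramp-involved σ {τ} inv with same-or-opp σ τ
    ... | inj₁ refl = ≤-trans (m⊓n≤n _ _) (≤-reflexive (sym (ramp-full {T = S} (total-C≤S σ) inv)))
    ... | inj₂ refl = ≤-trans (≤-reflexive (ramp-empty inv)) z≤n

    -- A move between path vertices changes one weight by at most one. Every other edge contains a
    -- long interval, where the clamped displacement cannot grow.
    ramp-step : ∀ σ → ramp-S σ S′ ≤ suc (ramp-S σ S)
    ramp-step σ = along (decode u) (decode v) refl refl uv
      where
      along-path : ∀ {x y} → decode u ≡ path x → decode v ≡ path y → pos σ y ≤ suc (pos σ x) →
                   ramp-S σ S′ ≤ suc (ramp-S σ S)
      along-path {x} {y} eu ev y≤x+1 = ≤-trans (ramp-mono (s * m) (d * m) (begin
        total σ S′                                    ≡⟨ weigh-S′ _ ⟩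
        ω σ (decode v) + total σ C                    ≡⟨ cong (λ w → ω σ w + total σ C) ev ⟩
        ramp (2 * k) m (pos σ y) + total σ C          ≤⟨ +-monoˡ-≤ (total σ C)
          (≤-trans (ramp-mono (2 * k) m y≤x+1) (ramp-suc (2 * k) m (pos σ x))) ⟩
        suc (ω σ (path x)) + total σ C                ≡⟨ cong (λ w → suc (ω σ w) + total σ C) eu ⟨
        suc (ω σ (decode u) + total σ C)              ≡⟨ cong suc (weigh-S _) ⟨
        suc (total σ S)                               ∎)) (ramp-suc (s * m) (d * m) (total σ S))
        where open ≤-Reasoning
      along : ∀ x y → decode u ≡ x → decode v ≡ y → Graph.Adj graph x y → ramp-S σ S′ ≤ suc (ramp-S σ S)
      along _ _ eu ev (inj₁ (path-path e)) = along-path eu ev (proj₂ (path-pos σ e))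
      along _ _ eu ev (inj₂ (path-path e)) = along-path eu ev (proj₁ (path-pos σ e))
      along _ _ eu ev (inj₁ (long-path _)) = m≤n⇒m≤1+n (ramp-involved σ (inj₁ eu))
      along _ _ eu ev (inj₁ (long-slot _)) = m≤n⇒m≤1+n (ramp-involved σ (inj₁ eu))
      along _ _ eu ev (inj₁ (long-long _)) = m≤n⇒m≤1+n (ramp-involved σ (inj₁ eu))
      along _ _ eu ev (inj₂ (long-path _)) = m≤n⇒m≤1+n (ramp-involved σ (inj₂ ev))
      along _ _ eu ev (inj₂ (long-slot _)) = m≤n⇒m≤1+n (ramp-involved σ (inj₂ ev))
      along _ _ eu ev (inj₂ (long-long _)) = m≤n⇒m≤1+n (ramp-involved σ (inj₂ ev))

    ∈S′ : ∀ {w} → w ∈ S′ → w ≡ v ⊎ w ∈ S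
    ∈S′ {w} w∈S′ with w Fin.≟ v
    ... | yes w≡v = inj₁ w≡v
    ... | no  w≢v = inj₂ (C⊆S (subst (w ∈_) (sym rest≡) (x∈p∧x≢y⇒x∈p-y w∈S′ w≢v)))

    module _ {σ i j moves} (stage : Stage σ i j moves S) where
      open Stage stage

      -- Without a new opening the bounds on parked tokens persist: a slot can only be entered
      -- through `long τ a` already opened, and then at most `toℕ a + 1` slots of that side are
      -- full.
      stay : (∀ {a} → decode v ≡ long σ a → toℕ a < i) → (∀ {a} → decode v ≡ long (opp σ) a → toℕ a < j) →
             Stage σ i j (suc moves) S′
      stay v< vᵒ< = record
        { j≡far    = j≡far
        ; i≤s      = i≤s
        ; j≤s      = j≤s
        ; #slots≤  = [ (λ le → ≤-trans le #slots≤) , (λ (_ , eu , le) → ≤-trans le (long< u∈S eu)) ]′ (#slots-step σ)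
        ; #slotsᵒ≤ = [ (λ le → ≤-trans le #slotsᵒ≤)
                     , (λ (_ , eu , le) → ≤-trans le (longᵒ< u∈S eu)) ]′ (#slots-step (opp σ))
        ; long<    = λ w∈S′ ew → [ (λ { refl → v< ew }) , (λ w∈S → long< w∈S ew) ]′ (∈S′ w∈S′)
        ; longᵒ<   = λ w∈S′ ew → [ (λ { refl → vᵒ< ew }) , (λ w∈S → longᵒ< w∈S ew) ]′ (∈S′ w∈S′)
        ; cost     = ≤-trans (+-monoʳ-≤ ((i + j) * (d * m)) (ramp-step σ))
                             (≤-trans (≤-reflexive (+-suc _ _)) (s≤s cost))
        }

      -- An opening completes a crossing. The ramp in the old direction is full before the move, so
      -- its `d * m` moves are booked as one more finished crossing; the ramp in the new direction
      -- is still empty after it.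
      advance : ∀ {a} → decode v ≡ long σ a → toℕ a ≡ i → Stage (opp σ) j (suc i) (suc moves) S′
      advance {a} ev refl = record
        { j≡far    = far-swap σ j≡far
        ; i≤s      = j≤s
        ; j≤s      = Fin.toℕ<n a
        ; #slots≤  = ≤-trans (#slots-S′≤ (opp σ)) #slotsᵒ≤
        ; #slotsᵒ≤ = subst (λ τ → #slots τ S′ ≤ suc i) (sym (opp-involutive σ))
                       (m≤n⇒m≤1+n (≤-trans (#slots-S′≤ σ) #slots≤))
        ; long<    = λ w∈S′ ew → [ (λ { refl → contradiction (trans (sym ev) ew) (long≢longᵒ σ) })
                                      , (λ w∈S → longᵒ< w∈S ew) ]′ (∈S′ w∈S′)
        ; longᵒ<   = λ {w} {b} w∈S′ ew →
            [ (λ { refl → s≤s (≤-reflexive (sym (long-index σ (trans (sym ev) ew)))) })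
            , (λ w∈S → m≤n⇒m≤1+n (long< w∈S (subst (λ τ → decode w ≡ long τ b) (opp-involutive σ) ew))) ]′ (∈S′ w∈S′)
        ; cost     = begin
            (j + suc i) * (d * m) + ramp-S (opp σ) S′   ≡⟨ cong ((j + suc i) * (d * m) +_)
              (ramp-empty (subst (λ τ → Involves τ a) (sym (opp-involutive σ)) (inj₂ ev))) ⟩
            (j + suc i) * (d * m) + 0                   ≡⟨ solve 3
              (λ i j c → (j :+ (con 1 :+ i)) :* c :+ con 0 := (i :+ j) :* c :+ c) refl i j (d * m) ⟩
            (i + j) * (d * m) + d * m                   ≡⟨ cong ((i + j) * (d * m) +_)
              (ramp-full {T = S} (total-C≤S σ) (inj₂ ev)) ⟨
            (i + j) * (d * m) + ramp-S σ S              ≤⟨ cost ⟩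
            moves                                       ≤⟨ n≤1+n moves ⟩
            suc moves                                   ∎
        }
        where
        open ≤-Reasoning
        open +-*-Solver
        #slots-S′≤ : ∀ τ → #slots τ S′ ≤ #slots τ S
        #slots-S′≤ τ = subst (_≤ #slots τ S)
          (sym (trans (weigh-S′ _) (cong (λ w → indicator (slotCell τ w) + #slots τ C) ev)))
          (subst (λ c → indicator c + #slots τ C ≤ #slots τ S) (sym (slotCell-long τ)) (#slots-C≤ τ))
          where
          slotCell-long : ∀ τ → slotCell τ (long σ a) ≡ nothing
          slotCell-long left  = refl
          slotCell-long right = refl
        long-index : ∀ σ {a b} → long σ a ≡ long (opp (opp σ)) b → toℕ a ≡ toℕ b
        long-index left  refl = refl
        long-index right refl = refl

      -- By `far-bound`, entering `long σ a` needs `far σ a` tokens parked opposite, where there are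
      -- at most `j = far σ i`. So either `a` is below `i` and the interval is already open, or
      -- `a = i` and a new stage begins.
      next : ∃ λ σ′ → ∃ λ i′ → ∃ λ j′ → Stage σ′ i′ j′ (suc moves) S′
      next = by (decode v) refl
        where
        far≤j : ∀ {a} → decode v ≡ long σ a → far σ (toℕ a) ≤ j
        far≤j ev = ≤-trans (far-bound (inj₂ ev)) (≤-trans (#slots-C≤ (opp σ)) #slotsᵒ≤)
        farᵒ≤i : ∀ {a} → decode v ≡ long (opp σ) a → far (opp σ) (toℕ a) ≤ i
        farᵒ≤i ev = ≤-trans (far-bound (inj₂ ev)) (≤-trans (#slots-C≤ (opp (opp σ)))
          (subst (λ τ → #slots τ S ≤ i) (sym (opp-involutive σ)) #slots≤))
        -- On the other side nothing new can be opened at this stage: an index from `j` on would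
        -- require more than `i` tokens parked on the side `σ`.
        far-order : ∀ σ {a} → far (opp σ) a ≤ i → far σ i ≤ a → ∀ {A : Set} → A
        far-order left  a<i i≤a = contradiction i≤a (<⇒≱ a<i)
        far-order right a≤i i<a = contradiction a≤i (<⇒≱ i<a)
        by : ∀ w → decode v ≡ w → ∃ λ σ′ → ∃ λ i′ → ∃ λ j′ → Stage σ′ i′ j′ (suc moves) S′
        by (path _)   ev = σ , i , j , stay (λ e → contradiction (trans (sym ev) e) λ ())
                                            (λ e → contradiction (trans (sym ev) e) λ ())
        by (slot _ _) ev = σ , i , j , stay (λ e → contradiction (trans (sym ev) e) λ ())
                                            (λ e → contradiction (trans (sym ev) e) λ ())
        by (long τ a) ev with same-or-opp σ τ | toℕ a <? i
        ... | inj₁ refl | no a≮i = opp σ , j , suc i , advance ev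
              (≤-antisym (far-cancel σ (subst (far σ (toℕ a) ≤_) j≡far (far≤j ev))) (≮⇒≥ a≮i))
        ... | inj₁ refl | yes a<i = σ , i , j , stay
              (λ e → subst (_< i) (same-long (trans (sym ev) e)) a<i) (λ e → contradiction (trans (sym ev) e) (long≢longᵒ σ))
          where
          same-long : ∀ {a b} → long σ a ≡ long σ b → toℕ a ≡ toℕ b
          same-long refl = refl
        ... | inj₂ refl | _ = σ , i , j , stay
              (λ e → contradiction (trans (sym e) ev) (long≢longᵒ σ))
              (λ {b} e → ≰⇒> λ j≤b → far-order σ (farᵒ≤i e) (subst (_≤ toℕ b) j≡far j≤b))

  -- The lower bound for complete sequences

  module _ {J : IndependentSet G k} (full : ∀ τ → s ≤ #slots τ (set J))
           (spread : s * m + d * m ≤ total left (set J)) where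

    -- Full slots force `i = j = s`. The invariant `j ≡ far σ i` then rules out the direction away
    -- from the right end, and towards the right the last ramp is full as well.
    final-bound : ∀ {σ i j moves} → Stage σ i j moves (set J) → (s + s) * (d * m) + d * m ≤ moves
    final-bound {σ} {i} {j} {moves} stage = conclude σ refl (≤-antisym i≤s (≤-trans (full σ) #slots≤))
      (≤-antisym j≤s (≤-trans (full (opp σ)) #slotsᵒ≤)) j≡far
      where
      open Stage stage
      conclude : ∀ τ → σ ≡ τ → i ≡ s → j ≡ s → j ≡ far τ i → (s + s) * (d * m) + d * m ≤ moves
      conclude right refl refl refl e = contradiction (sym e) 1+n≢n
      conclude left  refl refl refl _ = subst (λ r → (s + s) * (d * m) + r ≤ moves) (ramp-high spread) cost

    lower-bound : ∀ {σ i j moves I uvs} → Stage σ i j moves (set I) → IsReconfigurationSequence G I J uvs →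
                  (s + s) * (d * m) + d * m ≤ moves + length uvs
    lower-bound {moves = moves} stage [] = ≤-trans (final-bound stage) (m≤m+n moves 0)
    lower-bound {moves = moves} {I} {(u , v) ∷ uvs} stage (step {I′ = I′} II′ u-leaves v-enters seq) =
      ≤-trans (lower-bound (proj₂ (proj₂ (proj₂ next))) seq) (≤-reflexive (sym (+-suc moves _)))
      where
      open Slide G I I′ II′ u-leaves v-enters
      next = Move.next (independent G I) (independent G I′)
        (trans (weigh-1 (set I)) (size G I)) u∈I v∈I′ adjacent rest≡ stage

  -- Packed and parked tokens

  at : Side → (y : ℕ) → .(y < N) → Fin N
  at left  y y<N = fromℕ< y<N
  at right y y<N = opposite (fromℕ< y<N)

  pos-at : ∀ σ y .(y<N : y < N) → pos σ (at σ y y<N) ≡ y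
  pos-at left  y y<N = Fin.toℕ-fromℕ< y<N
  pos-at right y y<N = trans (cong toℕ (Fin.opposite-involutive (fromℕ< y<N))) (Fin.toℕ-fromℕ< y<N)

  2q<N : ∀ {q} → q < k → 2 * q < N
  2q<N {q} q<k = begin-strict
    2 * q            <⟨ *-monoʳ-< 2 q<k ⟩
    2 * k            ≤⟨ m≤m+n (2 * k) (2 * k) ⟩
    2 * k + 2 * k    ≤⟨ 2k+2k≤N ⟩
    N                ∎
    where open ≤-Reasoning

  -- The tokens stand on every second vertex from the end on. The bound is an irrelevant argument,
  -- so lists built from different proofs of it are definitionally equal.
  packed : Side → (q : ℕ) → .(q ≤ k) → List V
  packed σ zero    _   = []
  packed σ (suc q) q<k = path (at σ (2 * q) (2q<N q<k)) ∷ packed σ q (<⇒≤ q<k)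

  slots : Side → (i : ℕ) → .(i ≤ s) → List V
  slots σ zero    _   = []
  slots σ (suc i) i<s = slot σ (fromℕ< i<s) ∷ slots σ i (<⇒≤ i<s)

  -- Only the distance from the innermost packed vertex matters: anything at position `2 * q` or
  -- further is apart from all `q` tokens.
  data Packed (σ : Side) (q : ℕ) : V → Set where
    inside : ∀ {x} → 2 + pos σ x ≤ 2 * q → Packed σ q (path x)

  data Parked (σ : Side) (i : ℕ) : V → Set where
    inside : ∀ {j} → toℕ j < i → Parked σ i (slot σ j)

  all-packed : ∀ σ q .(q≤k : q ≤ k) → All (Packed σ q) (packed σ q q≤k)
  all-packed σ zero    _   = []
  all-packed σ (suc q) q<k = inside (≤-reflexive (trans (cong (2 +_) (pos-at σ (2 * q) (2q<N q<k))) (sym (*-suc 2 q))))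
    ∷ All.map (λ { (inside lt) → inside (≤-trans lt (*-monoʳ-≤ 2 (n≤1+n q))) }) (all-packed σ q (<⇒≤ q<k))

  all-parked : ∀ σ i .(i≤s : i ≤ s) → All (Parked σ i) (slots σ i i≤s)
  all-parked σ zero    _   = []
  all-parked σ (suc i) i<s = inside (s≤s (≤-reflexive (Fin.toℕ-fromℕ< i<s)))
    ∷ All.map (λ { (inside lt) → inside (m≤n⇒m≤1+n lt) }) (all-parked σ i (<⇒≤ i<s))

  _⊥_ : V → V → Set
  _⊥_ = Apart graph

  path⊥path : ∀ σ {x y} → 2 + pos σ y ≤ pos σ x → path x ⊥ path y
  path⊥path σ {x} {y} y+2≤x = (λ { refl → <-irrefl refl (≤-trans (n≤1+n _) y+2≤x) })
    , (λ { (inj₁ (path-path e)) → <⇒≱ y+2≤x (proj₁ (path-pos σ e))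
         ; (inj₂ (path-path e)) → <⇒≱ y+2≤x (proj₂ (path-pos σ e)) })

  path⊥slot : ∀ {x σ j} → path x ⊥ slot σ j
  path⊥slot = (λ ()) , λ { (inj₁ ()) ; (inj₂ ()) }

  slot⊥slot : ∀ {σ τ i j} → slot σ i ≢ slot τ j → slot σ i ⊥ slot τ j
  slot⊥slot ≢ = ≢ , λ { (inj₁ ()) ; (inj₂ ()) }

  long⊥ : ∀ {σ i v} → Avoids σ (toℕ i) v → long σ i ⊥ v
  long⊥ (near j<i)  = (λ ()) , λ { (inj₁ (long-slot i≤j)) → <⇒≱ j<i i≤j ; (inj₂ ()) }
  long⊥ (beyond lt) = (λ ()) , λ { (inj₁ (long-path ge)) → <⇒≱ lt ge ; (inj₂ ()) }
  long⊥ {σ} across  = (λ ()) , crosses σ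
    where
    crosses : ∀ σ {i j} → ¬ Graph.Adj graph (long σ i) (slot (opp σ) j)
    crosses left  (inj₁ ())
    crosses left  (inj₂ ())
    crosses right (inj₁ ())
    crosses right (inj₂ ())

  encode-apart : ∀ {u v} → u ⊥ v → Apart G (encode u) (encode v)
  encode-apart {u} {v} (u≢v , ¬uv) =
      (λ e → u≢v (trans (sym (decode-encode u)) (trans (cong decode e) (decode-encode v))))
    , (¬uv ∘ subst₂ (Graph.Adj graph) (decode-encode u) (decode-encode v))

  infix 4 _↝_

  _↝_ : List V → List V → Set
  us ↝ vs = _⇝_ G (map encode us) (map encode vs)

  slideⱽ : ∀ {u v vs} → Graph.Adj graph u v → All (v ⊥_) vs → u ∷ vs ↝ v ∷ vs
  slideⱽ {u} {v} uv v⊥ = slide (subst₂ (Graph.Adj graph) (sym (decode-encode u)) (sym (decode-encode v)) uv)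
    (All.map⁺ (All.map encode-apart v⊥))

  reorderⱽ : ∀ {us vs} → us ↭ vs → us ↝ vs
  reorderⱽ us↭vs = reorder (map⁺ encode us↭vs)

  -- The token visits every position from `y` to `z`, so all of them must be apart from the tokens
  -- in `R`.
  walk : ∀ σ {y z R} .(y<N : y < N) .(z<N : z < N) → y ≤′ z →
         (∀ x → y ≤ pos σ x → pos σ x ≤ z → All (path x ⊥_) R) →
         path (at σ y y<N) ∷ R ↝ path (at σ z z<N) ∷ R
  walk σ y<N z<N ≤′-refl free = reorder ↭-refl
  walk σ {y} {suc z} y<N z<N (≤′-step y≤z) free =
    walk σ y<N (<⇒≤ z<N) y≤z (λ x y≤x x≤z → free x y≤x (m≤n⇒m≤1+n x≤z))
    then slideⱽ (path-adj σ (trans (cong suc (pos-at σ z (<⇒≤ z<N))) (sym (pos-at σ (suc z) z<N))))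
                (free _ (subst (y ≤_) (sym (pos-at σ (suc z) z<N)) (m≤n⇒m≤1+n (≤′⇒≤ y≤z)))
                        (≤-reflexive (pos-at σ (suc z) z<N)))

  IsSlot : V → Set
  IsSlot v = ∃ λ σ → ∃ λ j → v ≡ slot σ j

  transfer : ∀ σ q r {X} (q+r<k : q + r < k) .(q<k : q < k) .(r<k : r < k) → All IsSlot X →
             packed σ (suc q) q<k ++ packed (opp σ) r (<⇒≤ r<k) ++ X ↝
             packed σ q (<⇒≤ q<k) ++ packed (opp σ) (suc r) r<k ++ X
  transfer σ q r {X} q+r<k q<k r<k slotX =
    walk σ {2 * q} {z} (2q<N q<k) z<N (≤⇒≤′ 2q≤z) free
    then reorderⱽ (↭-trans (↭-reflexive (cong (λ x → path x ∷ packed σ q _ ++ packed (opp σ) r _ ++ X) at-z))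
                           (↭-sym (shift (path target) (packed σ q _) (packed (opp σ) r _ ++ X))))
    where
    open ≤-Reasoning
    target : Fin N
    target = at (opp σ) (2 * r) (2q<N r<k)
    -- The walk is measured from `σ`, while the target is defined from the opposite end.
    z = pos σ target
    z+2r : z + suc (2 * r) ≡ N
    z+2r = trans (cong (λ y → z + suc y) (sym (pos-at (opp σ) (2 * r) (2q<N r<k)))) (pos-opp σ target)
    z<N : z < N
    z<N = subst (z <_) z+2r (m<m+n z (s≤s z≤n))
    at-z : at σ z z<N ≡ target
    at-z = pos-injective σ (pos-at σ z z<N)
    2q≤z : 2 * q ≤ z
    2q≤z = +-cancelʳ-≤ (suc (2 * r)) (2 * q) z (begin
      2 * q + suc (2 * r)      ≤⟨ n≤1+n _ ⟩
      suc (2 * q + suc (2 * r)) ≡⟨ solve 2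
        (λ q r → con 1 :+ (con 2 :* q :+ (con 1 :+ con 2 :* r)) := con 2 :* (con 1 :+ (q :+ r))) refl q r ⟩
      2 * suc (q + r)          ≤⟨ *-monoʳ-≤ 2 q+r<k ⟩
      2 * k                    ≤⟨ m≤m+n (2 * k) (2 * k) ⟩
      2 * k + 2 * k            ≤⟨ 2k+2k≤N ⟩
      N                        ≡⟨ z+2r ⟨
      z + suc (2 * r)          ∎)
      where open +-*-Solver
    free : ∀ x → 2 * q ≤ pos σ x → pos σ x ≤ z → All (path x ⊥_) (packed σ q _ ++ packed (opp σ) r _ ++ X)
    free x 2q≤x x≤z = All.++⁺ (All.map (λ { (inside lt) → path⊥path σ (≤-trans lt 2q≤x) }) (all-packed σ q _))
      (All.++⁺ (All.map (λ { (inside lt) → path⊥path (opp σ) (≤-trans lt 2r≤x) }) (all-packed (opp σ) r _))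
               (All.map (λ { (_ , _ , refl) → path⊥slot }) slotX))
      where
      2r≤x : 2 * r ≤ pos (opp σ) x
      2r≤x = ≤-pred (+-cancelˡ-≤ (pos σ x) _ _ (begin
        pos σ x + suc (2 * r)              ≤⟨ +-monoˡ-≤ (suc (2 * r)) x≤z ⟩
        z + suc (2 * r)                    ≡⟨ z+2r ⟩
        N                                  ≡⟨ pos-opp σ x ⟨
        pos σ x + suc (pos (opp σ) x)      ∎))

  transfers : ∀ σ t {q r a b X} → a ≡ t + q → b ≡ t + r → a + r ≤ k →
              .(a≤k : a ≤ k) .(b≤k : b ≤ k) .(q≤k : q ≤ k) .(r≤k : r ≤ k) →
              All IsSlot X → packed σ a a≤k ++ packed (opp σ) r r≤k ++ X ↝ packed σ q q≤k ++ packed (opp σ) b b≤k ++ X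
  transfers σ zero    refl refl _ _ _ _ _ _ = reorder ↭-refl
  transfers σ (suc t) {q} {r} refl refl a+r≤k a≤k b≤k q≤k r≤k slotX =
    transfer σ (t + q) r a+r≤k a≤k r<k slotX
    then transfers σ t refl (sym (+-suc t r)) (≤-trans (≤-reflexive (+-suc (t + q) r)) a+r≤k) (<⇒≤ a≤k) b≤k q≤k r<k slotX
    where
    r<k : r < k
    r<k = ≤-trans (s≤s (m≤n+m r (t + q))) a+r≤k

  -- The reconfiguration schedule

  conf : Side → (q i j : ℕ) → .(q ≤ k) → .(i ≤ s) → .(j ≤ s) → List V
  conf σ q i j q≤k i≤s j≤s = packed σ q q≤k ++ slots σ i i≤s ++ slots (opp σ) j j≤s

  all-slots : ∀ σ i .(i≤s : i ≤ s) → All IsSlot (slots σ i i≤s)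
  all-slots σ i i≤s = All.map (λ { (inside {j} _) → σ , j , refl }) (all-parked σ i i≤s)

  -- One opening and the crossing that prepares it; the roles of the two sides are exchanged
  -- afterwards.
  round : ∀ σ {q i j} → j ≡ far σ i → suc q + i + j ≡ k →
          .(q<k : q < k) .(q≤k : q ≤ k) .(i<s : i < s) .(i≤s : i ≤ s) .(j≤s : j ≤ s) →
          conf σ (suc q) i j q<k i≤s j≤s ↝ conf (opp σ) q j (suc i) q≤k j≤s i<s
  round σ {q} {i} {j} j≡far sum≡k q<k q≤k i<s i≤s j≤s =
    -- All packed tokens except the outermost cross to the other end.
    transfers σ q {1} {0} (+-comm 1 q) (sym (+-identityʳ q)) (≤-trans (≤-reflexive (+-identityʳ _)) q<k′)
      q<k q≤k (≤-trans (s≤s z≤n) q<k′) z≤n slotX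
    -- The token that stayed at position `0` steps onto the long interval, whose free end is just
    -- large enough for the others.
    then slideⱽ (inj₂ (long-path (≤-trans (2room≤2k σ _) (≤-trans (≤-trans (m≤m+n (2 * k) (2 * k)) 2k+2k≤N)
           (≤-reflexive (trans (sym (pos-opp σ x₀)) (cong (_+ suc (pos (opp σ) x₀)) (pos-at σ 0 0<N))))))))
         (All.++⁺ (All.map (λ { (inside lt) → long⊥ (beyond (≤-trans lt (*-monoʳ-≤ 2 q≤room))) }) (all-packed (opp σ) q _))
           (All.++⁺ (All.map (λ { (inside lt) → long⊥ (near (subst (_ <_) (sym a≡i) lt)) }) (all-parked σ i _))
                    (All.map (λ { (inside _) → long⊥ across }) (all-parked (opp σ) j _))))
    -- From there it is parked in the slot at which this long interval starts.
    then slideⱽ (inj₁ (long-slot ≤-refl))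
         (All.++⁺ (All.map (λ { (inside _) → Apart-sym graph path⊥slot }) (all-packed (opp σ) q _))
           (All.++⁺ (All.map (λ { (inside lt) → slot⊥slot λ { refl → <-irrefl a≡i lt } }) (all-parked σ i _))
                    (All.map (λ { (inside _) → slot⊥slot (slot≢slotᵒ σ) }) (all-parked (opp σ) j _))))
    then reorderⱽ final
    where
    q<k′ : q < k
    q<k′ = subst (suc q ≤_) sum≡k (≤-trans (m≤m+n (suc q) i) (m≤m+n (suc q + i) j))
    0<N : 0 < N
    0<N = 2q<N {0} (≤-trans (s≤s z≤n) q<k′)
    x₀ : Fin N
    x₀ = at σ 0 0<N
    slotX : All IsSlot (slots σ i i≤s ++ slots (opp σ) j j≤s)
    slotX = All.++⁺ (all-slots σ i i≤s) (all-slots (opp σ) j j≤s)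
    a≡i : toℕ (fromℕ< i<s) ≡ i
    a≡i = Fin.toℕ-fromℕ< i<s
    q≤room : q ≤ room σ (toℕ (fromℕ< i<s))
    q≤room = subst (λ a → q ≤ room σ a) (sym a≡i) (m+n≤o⇒m≤o∸n q (≤-reflexive (begin-equality
      q + suc (i + far σ i)  ≡⟨ cong (λ f → q + suc (i + f)) j≡far ⟨
      q + suc (i + j)        ≡⟨ solve 3 (λ q i j → q :+ (con 1 :+ (i :+ j)) := con 1 :+ q :+ i :+ j) refl q i j ⟩
      suc q + i + j          ≡⟨ sum≡k ⟩
      k                      ∎)))
      where
      open ≤-Reasoning
      open +-*-Solver
    final : slot σ (fromℕ< i<s) ∷ packed (opp σ) q _ ++ slots σ i _ ++ slots (opp σ) j _ ↭ conf (opp σ) q j (suc i) _ _ _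
    final = subst (λ ρ → slot σ (fromℕ< i<s) ∷ packed (opp σ) q q≤k ++ slots σ i i≤s ++ slots (opp σ) j j≤s ↭
                   packed (opp σ) q q≤k ++ slots (opp σ) j j≤s ++ slots ρ (suc i) i<s) (sym (opp-involutive σ))
      (↭-trans (↭-sym (shift (slot σ (fromℕ< i<s)) (packed (opp σ) q _) _))
        (++⁺ˡ (packed (opp σ) q _) (++-comm (slots σ (suc i) _) (slots (opp σ) j _))))

  -- Here `t` is the number of slots still empty on each side. A left and a right round fill one
  -- slot on each side and restore the direction.
  rounds : ∀ t {i q} → t + i ≡ s → q ≡ t + t + d →
           .(q≤k : q ≤ k) .(i≤s : i ≤ s) .(d≤k : d ≤ k) .(s≤ : s ≤ s) →
           conf left q i i q≤k i≤s i≤s ↝ conf left d s s d≤k s≤ s≤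
  rounds zero refl refl _ _ _ _ = reorder ↭-refl
  rounds (suc t) {i} refl refl q≤k i≤s d≤k s≤ =
    -- The bound is quantified inside the motive so that it changes along with the number of packed
    -- tokens.
    subst (λ q → ∀ .(q≤k : q ≤ k) → conf left q i i q≤k i≤s i≤s ↝ conf left d s s d≤k s≤ s≤) (sym e) go q≤k
    where
    open +-*-Solver
    q = t + t + d
    e : suc t + suc t + d ≡ suc (suc q)
    e = solve 2 (λ t d → con 1 :+ t :+ (con 1 :+ t) :+ d := con 2 :+ (t :+ t :+ d)) refl t d
    i<s : i < s
    i<s = s≤s (m≤n+m i t)
    go : ∀ .(q≤k : suc (suc q) ≤ k) → conf left (suc (suc q)) i i q≤k i≤s i≤s ↝ conf left d s s d≤k s≤ s≤
    go q≤k = round left refl (solve 3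
               (λ t i d → con 2 :+ (t :+ t :+ d) :+ i :+ i := con 1 :+ t :+ i :+ (con 1 :+ t :+ i) :+ d) refl t i d)
               q≤k (<⇒≤ q≤k) i<s i≤s i≤s
      then round right refl (solve 3
               (λ t i d → con 1 :+ (t :+ t :+ d) :+ i :+ (con 1 :+ i) := con 1 :+ t :+ i :+ (con 1 :+ t :+ i) :+ d) refl t i d)
               (<⇒≤ q≤k) (<⇒≤ (<⇒≤ q≤k)) i<s i≤s i<s
      then rounds t (+-suc t i) refl (<⇒≤ (<⇒≤ q≤k)) i<s d≤k s≤

  -- Start and finish, and their weights

  sum-const : ∀ (g : V → ℕ) {c vs} → All (λ v → g v ≡ c) vs → sum (map g vs) ≡ length vs * c
  sum-const g []       = refl
  sum-const g (e ∷ es) = cong₂ _+_ e (sum-const g es)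

  length-packed : ∀ σ q .(q≤k : q ≤ k) → length (packed σ q q≤k) ≡ q
  length-packed σ zero    _   = refl
  length-packed σ (suc q) q<k = cong suc (length-packed σ q (<⇒≤ q<k))

  length-slots : ∀ σ i .(i≤s : i ≤ s) → length (slots σ i i≤s) ≡ i
  length-slots σ zero    _   = refl
  length-slots σ (suc i) i<s = cong suc (length-slots σ i (<⇒≤ i<s))

  sum-packed : ∀ (g : V → ℕ) c σ q .(q≤k : q ≤ k) →
               (∀ {v} → Packed σ q v → g v ≡ c) → sum (map g (packed σ q q≤k)) ≡ q * c
  sum-packed g c σ q q≤k const = trans (sum-const g (All.map const (all-packed σ q q≤k)))
                                       (cong (_* c) (length-packed σ q q≤k))

  sum-slots : ∀ (g : V → ℕ) c σ i .(i≤s : i ≤ s) →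
              (∀ j → g (slot σ j) ≡ c) → sum (map g (slots σ i i≤s)) ≡ i * c
  sum-slots g c σ i i≤s const = trans (sum-const g (All.map (λ { (inside {j} _) → const j }) (all-parked σ i i≤s)))
                                      (cong (_* c) (length-slots σ i i≤s))

  weigh-list : ∀ (g : V → ℕ) {vs} → Scattered G (map encode vs) →
               weigh (g ∘ decode) (toSet (map encode vs)) ≡ sum (map g vs)
  weigh-list g {vs} sc = trans (weigh-toSet G (g ∘ decode) sc)
    (cong sum (trans (sym (map-∘ vs)) (map-cong (λ v → cong g (decode-encode v)) vs)))

  start finish : List V
  start  = packed left k ≤-refl
  finish = packed right d (m≤n+m d (s + s)) ++ slots left s ≤-refl ++ slots right s ≤-refl

  start↝finish : start ↝ finish
  start↝finish = reorderⱽ (↭-reflexive (sym (++-identityʳ start)))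
    then rounds s (+-identityʳ s) refl ≤-refl z≤n d≤k ≤-refl
    -- With all slots full, the `d` tokens left on the path make the last of the `2s + 1` crossings.
    then transfers left d (sym (+-identityʳ d)) (sym (+-identityʳ d)) (≤-trans (≤-reflexive (+-identityʳ d)) d≤k)
           d≤k d≤k z≤n z≤n
           (All.++⁺ (all-slots left s ≤-refl) (all-slots right s ≤-refl))
    where
    d≤k : d ≤ k
    d≤k = m≤n+m d (s + s)

  scattered-packed : ∀ σ q .(q≤k : q ≤ k) → AllPairs _⊥_ (packed σ q q≤k)
  scattered-packed σ zero    _   = []
  scattered-packed σ (suc q) q<k =
    All.map (λ { (inside lt) → path⊥path σ (≤-trans lt (≤-reflexive (sym (pos-at σ (2 * q) (2q<N q<k))))) })
            (all-packed σ q (<⇒≤ q<k))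
    ∷ scattered-packed σ q (<⇒≤ q<k)

  scattered-start : Scattered G (map encode start)
  scattered-start = AllPairs.map⁺ (AllPairs.map encode-apart (scattered-packed left k ≤-refl))

  length-start : length (map encode start) ≡ k
  length-start = trans (length-map encode start) (length-packed left k ≤-refl)

  reconfiguration = ⇝⇒Reconfigurable G start↝finish scattered-start length-start

  I J : IndependentSet G k
  I = fromList G (map encode start) scattered-start length-start
  J = fromList G (map encode finish) (proj₁ reconfiguration) (proj₁ (proj₂ reconfiguration))

  reconfigurable : Reconfigurable G I J
  reconfigurable = proj₂ (proj₂ reconfiguration)

  scattered-finish : Scattered G (map encode finish)
  scattered-finish = proj₁ reconfiguration

  slotCell-path : ∀ σ {x} → slotCell σ (path x) ≡ nothing
  slotCell-path left  = refl
  slotCell-path right = refl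

  initial : Stage left 0 0 0 (set I)
  initial = record
    { j≡far    = refl
    ; i≤s      = z≤n
    ; j≤s      = z≤n
    ; #slots≤  = ≤-reflexive (no-slots left)
    ; #slotsᵒ≤ = ≤-reflexive (no-slots right)
    ; long<    = no-long
    ; longᵒ<   = no-long
    ; cost     = ≤-reflexive (ramp-low {s * m} (≤-trans (≤-reflexive no-weight) z≤n))
    }
    where
    no-slots : ∀ σ → #slots σ (set I) ≡ 0
    no-slots σ = trans (weigh-list (indicator ∘ slotCell σ) scattered-start)
      (trans (sum-packed _ 0 left k ≤-refl λ { (inside _) → cong indicator (slotCell-path σ) }) (*-zeroʳ k))
    no-weight : total left (set I) ≡ 0
    no-weight = trans (weigh-list (ω left) scattered-start)
      (trans (sum-packed _ 0 left k ≤-refl λ { (inside lt) → ramp-low (≤-trans (≤-trans (n≤1+n _) (n≤1+n _)) lt) }) (*-zeroʳ k))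
    no-long : ∀ {v σ a} {A : Set} → v ∈ set I → decode v ≡ long σ a → A
    no-long {v} v∈I ev with ∈-map⁻ encode (∈-toSet⁻ (map encode start) v∈I)
    ... | w , w∈ , refl = impossible (All.lookup (all-packed left k ≤-refl) w∈) (trans (sym (decode-encode w)) ev)
      where
      impossible : ∀ {w σ a} {A : Set} → Packed left k w → w ≡ long σ a → A
      impossible (inside _) ()

  -- Each weight needed is constant on the packed tokens and on either row of slots, so this one
  -- evaluation serves the slot counts in `full` and the displacement in `spread`.
  sum-finish : ∀ g a b c → (∀ {v} → Packed right d v → g v ≡ a) →
               (∀ j → g (slot left j) ≡ b) → (∀ j → g (slot right j) ≡ c) →
               weigh (g ∘ decode) (set J) ≡ d * a + (s * b + s * c)
  sum-finish g a b c paths lefts rights = begin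
    weigh (g ∘ decode) (set J)                     ≡⟨ weigh-list g scattered-finish ⟩
    sum (map g finish)                             ≡⟨ sum-map-++ (packed right d (m≤n+m d (s + s))) _ ⟩
    sum (map g (packed right d _)) + sum (map g (slots left s _ ++ slots right s _))
                                                   ≡⟨ cong (sum (map g (packed right d (m≤n+m d (s + s)))) +_)
                                                        (sum-map-++ (slots left s ≤-refl) (slots right s ≤-refl)) ⟩
    sum (map g (packed right d _)) + (sum (map g (slots left s _)) + sum (map g (slots right s _)))
                                                   ≡⟨ cong₂ _+_ (sum-packed g a right d (m≤n+m d (s + s)) paths)
                                                        (cong₂ _+_ (sum-slots g b left s ≤-refl lefts)
                                                                   (sum-slots g c right s ≤-refl rights)) ⟩
    d * a + (s * b + s * c)                        ∎
    where
    open ≡-Reasoning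
    sum-map-++ : ∀ us vs → sum (map g (us ++ vs)) ≡ sum (map g us) + sum (map g vs)
    sum-map-++ us vs = trans (cong sum (map-++ g us vs)) (sum-++ (map g us) (map g vs))

  full : ∀ τ → s ≤ #slots τ (set J)
  full left  = ≤-reflexive (sym (trans
    (sum-finish (indicator ∘ slotCell left) 0 1 0 (λ { (inside _) → refl }) (λ _ → refl) (λ _ → refl))
    (solve 2 (λ d s → d :* con 0 :+ (s :* con 1 :+ s :* con 0) := s) refl d s)))
    where open +-*-Solver
  full right = ≤-reflexive (sym (trans
    (sum-finish (indicator ∘ slotCell right) 0 0 1 (λ { (inside _) → refl }) (λ _ → refl) (λ _ → refl))
    (solve 2 (λ d s → d :* con 0 :+ (s :* con 0 :+ s :* con 1) := s) refl d s)))
    where open +-*-Solver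

  spread : s * m + d * m ≤ total left (set J)
  spread = ≤-reflexive (sym (trans (sum-finish (ω left) m 0 m at-right (λ _ → refl) (λ _ → refl))
    (solve 3 (λ d s m → d :* m :+ (s :* con 0 :+ s :* m) := s :* m :+ d :* m) refl d s m)))
    where
    open +-*-Solver
    at-right : ∀ {v} → Packed right d v → ω left v ≡ m
    at-right (inside {x} lt) = weight≡m left x (≤-trans (≤-trans (n≤1+n _) lt) (*-monoʳ-≤ 2 (m≤n+m d (s + s))))

  length≥ : ∀ uvs → IsReconfigurationSequence G I J uvs → (s + s) * (d * m) + d * m ≤ length uvs
  length≥ uvs seq = lower-bound full spread initial seq

-- Choice of parameters and constants

open Intervals using (fromℕ-mono-≤; fromℕ-*)
open import Data.Integer using (+_)
open import Data.Nat using (_+_; _≥_) renaming (_*_ to _*ℕ_; _^_ to _^ℕ_; _≤_ to _≤ℕ_; _/_ to _/ℕ_; _%_ to _%ℕ_)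
import Data.Nat.DivMod as ℕ
import Data.Nat.Properties as ℕ
open import Data.Rational using (ℚ; 0ℚ; _<_; _≤_; _*_; _/_)
import Data.Rational.Properties as ℚ

Bounds : ℕ → ℕ → Set₁
Bounds m k =
  ∃ λ (n : ℕ) → ∃ λ (G : Graph (Fin n)) →
    IsIntervalGraph G ×
    fromℕ n ≤ fromℕ 6 * fromℕ (m + k) ×
    (∃ λ (I : IndependentSet G k) → ∃ λ (J : IndependentSet G k) →
      Reconfigurable G I J ×
      (∀ moves → IsReconfigurationSequence G I J moves →
        (+ 1 / 8) * fromℕ (k ^ℕ 2 *ℕ m) ≤ fromℕ (length moves)))

-- With `k = 4s + r`, the number `2s + 1` of crossings is at least `k / 4` and the number
-- `d = 2s + r` of walking tokens is at least `k / 2`; the product yields the constant `1 / 8`.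
bounds : ∀ m s r → r ≤ℕ 4 → Bounds m (s + s + (s + s + r))
bounds m s r r≤4 = n , G , isIntervalGraph-G , few-vertices , I , J , reconfigurable ,
  λ moves seq → many-moves (length≥ moves seq)
  where
  d = s + s + r
  open Corridor m s d
  open +-*-Solver

  few-vertices : fromℕ n ≤ fromℕ 6 * fromℕ (m + k)
  few-vertices = subst (fromℕ n ≤_) (sym (fromℕ-* 6 (m + k)))
    -- The graph has `4k + m + 4s` vertices, and `4s` is at most `2k`, whence the constant `6`.
    (fromℕ-mono-≤ (ℕ.≤-trans (ℕ.m≤m+n n (5 *ℕ m + 2 *ℕ d))
    (ℕ.≤-reflexive (solve 3 (λ m s d → let k = s :+ s :+ d in
      (k :+ k :+ m :+ (k :+ k)) :+ ((s :+ s) :+ (s :+ s)) :+ (con 5 :* m :+ con 2 :* d) := con 6 :* (m :+ k)) refl m s d))))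

  k²m≤ : ∀ {ℓ} → (s + s) *ℕ (d *ℕ m) + d *ℕ m ≤ℕ ℓ → k ^ℕ 2 *ℕ m ≤ℕ 8 *ℕ ℓ
  k²m≤ {ℓ} ≤ℓ = begin
    k ^ℕ 2 *ℕ m                                  ≡⟨ cong (λ x → k *ℕ x *ℕ m) (ℕ.*-identityʳ k) ⟩
    k *ℕ k *ℕ m                                  ≤⟨ ℕ.*-monoˡ-≤ m (ℕ.*-mono-≤ k≤4[2s+1] k≤2d) ⟩
    (4 *ℕ (s + s) + 4) *ℕ (2 *ℕ d) *ℕ m          ≡⟨ solve 3 (λ s d m → (con 4 :* (s :+ s) :+ con 4) :* (con 2 :* d) :* m
                                                      := con 8 :* ((s :+ s) :* (d :* m) :+ d :* m)) refl s d m ⟩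
    8 *ℕ ((s + s) *ℕ (d *ℕ m) + d *ℕ m)          ≤⟨ ℕ.*-monoʳ-≤ 8 ≤ℓ ⟩
    8 *ℕ ℓ                                       ∎
    where
    open ℕ.≤-Reasoning
    k≤4[2s+1] : k ≤ℕ 4 *ℕ (s + s) + 4
    k≤4[2s+1] = begin
      s + s + (s + s + r)                        ≤⟨ ℕ.m≤m+n _ (4 *ℕ s) ⟩
      s + s + (s + s + r) + 4 *ℕ s               ≡⟨ solve 2
        (λ s r → s :+ s :+ (s :+ s :+ r) :+ con 4 :* s := con 4 :* (s :+ s) :+ r) refl s r ⟩
      4 *ℕ (s + s) + r                           ≤⟨ ℕ.+-monoʳ-≤ (4 *ℕ (s + s)) r≤4 ⟩
      4 *ℕ (s + s) + 4                           ∎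
    k≤2d : k ≤ℕ 2 *ℕ d
    k≤2d = ℕ.≤-trans (ℕ.m≤m+n k r) (ℕ.≤-reflexive
      (solve 2 (λ s r → s :+ s :+ (s :+ s :+ r) :+ r := con 2 :* (s :+ s :+ r)) refl s r))

  many-moves : ∀ {ℓ} → (s + s) *ℕ (d *ℕ m) + d *ℕ m ≤ℕ ℓ → (+ 1 / 8) * fromℕ (k ^ℕ 2 *ℕ m) ≤ fromℕ ℓ
  many-moves {ℓ} ≤ℓ = begin
    (+ 1 / 8) * fromℕ (k ^ℕ 2 *ℕ m)      ≤⟨ ℚ.*-monoˡ-≤-nonNeg (+ 1 / 8) (fromℕ-mono-≤ (k²m≤ ≤ℓ)) ⟩
    (+ 1 / 8) * fromℕ (8 *ℕ ℓ)           ≡⟨ cong ((+ 1 / 8) *_) (fromℕ-* 8 ℓ) ⟨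
    (+ 1 / 8) * (fromℕ 8 * fromℕ ℓ)      ≡⟨ ℚ.*-assoc (+ 1 / 8) (fromℕ 8) (fromℕ ℓ) ⟨
    (+ 1 / 8) * fromℕ 8 * fromℕ ℓ        ≡⟨ ℚ.*-identityˡ (fromℕ ℓ) ⟩
    fromℕ ℓ                              ∎
    where open ℚ.≤-Reasoning

theorem2 : ∃ λ (c₁ : ℚ) → ∃ λ (c₂ : ℚ) → 0ℚ < c₁ × 0ℚ < c₂ ×
    (∀ (m k : ℕ) → m ≥ 1 → k ≥ 1 →
    ∃ λ (n : ℕ) → ∃ λ (G : Graph (Fin n)) →
    IsIntervalGraph G ×
    fromℕ n ≤ c₁ * fromℕ (m + k) ×
    (∃ λ (I : IndependentSet G k) → ∃ λ (J : IndependentSet G k) →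
    Reconfigurable G I J ×
    (∀ moves → IsReconfigurationSequence G I J moves →
    c₂ * fromℕ (k ^ℕ 2 *ℕ m) ≤ fromℕ (length moves))))
theorem2 = fromℕ 6 , + 1 / 8 , ℚ.positive⁻¹ (fromℕ 6) , ℚ.positive⁻¹ (+ 1 / 8) , λ m k _ _ →
  subst (Bounds m) (split k) (bounds m (k /ℕ 4) (k %ℕ 4) (ℕ.<⇒≤ (ℕ.m%n<n k 4)))
  where
  split : ∀ k → k /ℕ 4 + k /ℕ 4 + (k /ℕ 4 + k /ℕ 4 + k %ℕ 4) ≡ k
  split k = trans (solve 2 (λ s r → s :+ s :+ (s :+ s :+ r) := r :+ s :* con 4) refl (k /ℕ 4) (k %ℕ 4))
                  (sym (ℕ.m≡m%n+[m/n]*n k 4))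
    where open +-*-Solver
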